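{- Let $r\ge1$ and $s\ge2$, and let $a^r$ denote $r$ copies of $a$. Define the following patterns of length $s(r+1)$: $Q_1=s\,0^r\,(s-1)\,0^r\cdots 1\,0^r$ (concatenation of the blocks $i\,0^r$ for $i=s,s-1,\dots,1$); $Q_2=s\,(s-1)^r\,s\,(s-2)^r\,s\cdots s\,1^r\,s\,0^r$ (concatenation of the blocks $s\,i^r$ for $i=s-1,s-2,\dots,0$); $Q_3=s\,(s-1)^r(s-1)\,(s-2)^r(s-2)\cdots1^r1\,0^r$ (the entry $s$, followed by the blocks $i^r\,i$ for $i=s-1,\dots,1$, followed by $0^r$). Then the consecutive patterns $Q_1,Q_2,Q_3$ are pairwise super-strongly Wilf equivalent.
   Context: An inversion sequence of length $n$ is an integer sequence $e=e_1e_2\dots e_n$ with $0\le e_i<i$ for all $i$; $\mathbf{I}_n$ denotes the set of these. The reduction of an integer word $w$ is obtained by replacing every occurrence of the $i$-th smallest distinct value of $w$ by $i-1$. For a pattern $p$ of length $m$, $\mathrm{Em}(p,e)$ is the set of positions $i$ such that the reduction of $e_i\dots e_{i+m-1}$ equals $p$. Two patterns are super-strongly Wilf equivalent if $|\{e\in\mathbf{I}_n:\mathrm{Em}(p,e)=T\}|=|\{e\in\mathbf{I}_n:\mathrm{Em}(p',e)=T\}|$ for all $n$ and all $T\subseteq[n]$. -}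

module Defs where

open import Data.Bool.Properties using () renaming (_≟_ to _≟ᵇ_)
open import Data.Fin.Base as Fin using (Fin; toℕ)
open import Data.Fin.Subset using (Subset)
open import Data.List.Base using (List; []; _∷_; _++_; [_]; map; concatMap; length; filter;
  deduplicate; take; drop; replicate; downFrom; upTo; cartesianProductWith)
open import Data.List.Membership.Propositional using (_∈_)
open import Data.List.Membership.Propositional.Properties
  using (∈-cartesianProductWith⁺; ∈-cartesianProductWith⁻; ∈-upTo⁺; ∈-upTo⁻)
open import Data.List.Properties using (≡-dec)
open import Data.List.Relation.Unary.AllPairs using ([]; _∷_)
open import Data.List.Relation.Unary.All using ([])
open import Data.List.Relation.Unary.Any using (here)
open import Data.List.Relation.Unary.Unique.Propositional using (Unique)
open import Data.List.Relation.Unary.Unique.Propositional.Properties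
  using (cartesianProductWith⁺; upTo⁺)
open import Data.Nat.Base using (ℕ; zero; suc; _+_; _∸_; _<_)
open import Data.Nat.Properties using (_≟_; _<?_; +-suc)
open import Data.Product.Base using (_,_; _×_; proj₁; proj₂)
open import Data.Vec.Base using (Vec; []; _∷_; _∷ʳ_; lookup; toList; tabulate; initLast)
open import Data.Vec.Properties using (∷ʳ-injective) renaming (≡-dec to Vec-≡-dec)
open import Function.Bundles using (_⇔_; mk⇔)
open import Relation.Binary.PropositionalEquality using (_≡_; refl; subst; sym)
open import Relation.Nullary.Decidable using (does)

-- Positions are elements of Fin n: k : Fin n stands for the position toℕ k + 1
-- of [n], so that eᵢ < i reads lookup e k < suc (toℕ k).
IsInversionSequence : ∀ {n} → Vec ℕ n → Set
IsInversionSequence {n} e = ∀ (k : Fin n) → lookup e k < suc (toℕ k)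

-- The set 𝐈ₙ as a list; the lemmas ∈-𝐈⇔ and 𝐈-unique below show that it contains
-- each inversion sequence exactly once, and nothing else.
𝐈 : ∀ n → List (Vec ℕ n)
𝐈 zero    = [ [] ]
𝐈 (suc n) = cartesianProductWith _∷ʳ_ (𝐈 n) (upTo (suc n))

-- The i-th smallest distinct value of w has exactly i - 1 distinct values of w below it.
reduction : List ℕ → List ℕ
reduction w = map (λ x → length (filter (_<? x) (deduplicate _≟_ w))) w

-- If fewer than m = length p letters remain from position k on, the factor is
-- shorter than m, hence so is its reduction, and k is not in Em p e.
Em : ∀ {n} → List ℕ → Vec ℕ n → Subset n
Em p e = tabulate λ k →
  does (≡-dec _≟_ (reduction (take (length p) (drop (toℕ k) (toList e)))) p)

-- |{ e ∈ 𝐈ₙ : Em(p,e) = T }|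
countEm : ∀ n → List ℕ → Subset n → ℕ
countEm n p T = length (filter (λ e → Vec-≡-dec _≟ᵇ_ (Em p e) T) (𝐈 n))

SuperStronglyWilfEquivalent : List ℕ → List ℕ → Set
SuperStronglyWilfEquivalent p p′ = ∀ n (T : Subset n) → countEm n p T ≡ countEm n p′ T

-- downFrom s = s-1, …, 1, 0.
Q₁ Q₂ Q₃ : (r s : ℕ) → List ℕ
Q₁ r s = concatMap (λ i → i ∷ replicate r 0) (map suc (downFrom s))
Q₂ r s = concatMap (λ i → s ∷ replicate r i) (downFrom s)
Q₃ r s = s ∷ concatMap (λ i → replicate r i ++ [ i ]) (map suc (downFrom (s ∸ 1)))
           ++ replicate r 0

private
  ∷ʳ-bounded⁺ : ∀ {n} b (e : Vec ℕ n) x →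
    (∀ k → lookup e k < suc (b + toℕ k)) → x < suc (b + n) →
    ∀ k → lookup (e ∷ʳ x) k < suc (b + toℕ k)
  ∷ʳ-bounded⁺ b []      x h x< Fin.zero    = x<
  ∷ʳ-bounded⁺ b (y ∷ e) x h x< Fin.zero    = h Fin.zero
  ∷ʳ-bounded⁺ {suc n} b (y ∷ e) x h x< (Fin.suc k) rewrite +-suc b (toℕ k) =
    ∷ʳ-bounded⁺ (suc b) e x
      (λ j → subst (λ m → lookup e j < suc m) (+-suc b (toℕ j)) (h (Fin.suc j)))
      (subst (λ m → x < suc m) (+-suc b n) x<) k

  ∷ʳ-bounded⁻ : ∀ {n} b (e : Vec ℕ n) x →
    (∀ k → lookup (e ∷ʳ x) k < suc (b + toℕ k)) →
    (∀ k → lookup e k < suc (b + toℕ k)) × x < suc (b + n)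
  ∷ʳ-bounded⁻ b []      x h = (λ ()) , h Fin.zero
  ∷ʳ-bounded⁻ {suc n} b (y ∷ e) x h = bounded , subst (λ m → x < suc m) (sym (+-suc b n)) (proj₂ ih)
    where
    ih = ∷ʳ-bounded⁻ (suc b) e x
      (λ j → subst (λ m → lookup (e ∷ʳ x) j < suc m) (+-suc b (toℕ j)) (h (Fin.suc j)))
    bounded : ∀ k → lookup (y ∷ e) k < suc (b + toℕ k)
    bounded Fin.zero    = h Fin.zero
    bounded (Fin.suc k) = subst (λ m → lookup e k < suc m) (sym (+-suc b (toℕ k))) (proj₁ ih k)

  𝐈-sound : ∀ n {e} → e ∈ 𝐈 n → IsInversionSequence e
  𝐈-sound zero {[]} _ ()
  𝐈-sound (suc n) e∈
    with e , x , e∈𝐈 , x∈ , refl ← ∈-cartesianProductWith⁻ _∷ʳ_ (𝐈 n) (upTo (suc n)) e∈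
    = ∷ʳ-bounded⁺ 0 e x (𝐈-sound n e∈𝐈) (∈-upTo⁻ x∈)

  𝐈-complete : ∀ n {e} → IsInversionSequence e → e ∈ 𝐈 n
  𝐈-complete zero {[]} _ = here refl
  𝐈-complete (suc n) {e} h with initLast e
  ... | e′ , x , refl with he , hx ← ∷ʳ-bounded⁻ 0 e′ x h =
    ∈-cartesianProductWith⁺ _∷ʳ_ (𝐈-complete n he) (∈-upTo⁺ hx)

∈-𝐈⇔ : ∀ {n} {e : Vec ℕ n} → e ∈ 𝐈 n ⇔ IsInversionSequence e
∈-𝐈⇔ {n} = mk⇔ (𝐈-sound n) (𝐈-complete n)

𝐈-unique : ∀ n → Unique (𝐈 n)
𝐈-unique zero    = [] ∷ []
𝐈-unique (suc n) =
  cartesianProductWith⁺ _∷ʳ_ (∷ʳ-injective _ _) (𝐈-unique n) (upTo⁺ (suc n))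

{-# OPTIONS --safe #-}
module Submission where

-- Möbius inversion over supersets reduces the claim to counting the inversion sequences with
-- T ⊆ Em(p,e). Put q = r + 1. A descent inside an occurrence only occurs at a multiple of q, so
-- overlapping occurrences are shifted by a multiple of q or share a single letter. Call the q
-- letters from position t + aq on, for t ∈ T and a < s, a row, and call it linked if a + 1 < s.
-- For each of the three patterns, T ⊆ Em(Qⱼ,e) says that every row is a letter followed by r
-- equal smaller letters, together with a condition on each linked row: if it and the next row
-- read x m^r and x′ m′^r, then
--   Q₁: x > x′, m = m′;   Q₂: x = x′, m > m′;   Q₃: x′ = m.
-- Hence for Q₂ and for Q₃ the sequence is determined by its letters other than the x′, and for
-- Q₁ and for Q₃ by its letters other than the m; in both cases the same partial sequences extend.

open import Data.Bool.Base using (true; false)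
open import Data.Bool.Properties using () renaming (_≟_ to _≟ᵇ_)
open import Data.Fin.Base using (Fin; toℕ; fromℕ<)
open import Data.Fin.Properties using (any?; toℕ<n; toℕ-fromℕ<)
open import Data.Fin.Subset using (Subset; inside; outside; _⊆_) renaming (_∈_ to _∈ˢ_)
open import Data.Fin.Subset.Properties using (_⊆?_) renaming (_∈?_ to _∈ˢ?_)
open import Data.List.Base using (List; []; _∷_; _++_; [_]; map; concatMap; length; filter;
  deduplicate; take; drop; replicate; upTo; downFrom)
open import Data.List.Membership.Propositional using (_∈_)
open import Data.List.Membership.Propositional.Properties using (∈-∃++; ∈-++⁻; ∈-++⁺ˡ; ∈-++⁺ʳ;
  ∈-map⁺; ∈-upTo⁺; ∈-upTo⁻; ∈-filter⁺; ∈-filter⁻; ∈-deduplicate⁺; ∈-deduplicate⁻)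
open import Data.List.Properties using (≡-dec; length-++; length-map; length-drop; length-take;
  length-upTo; length-downFrom; concatMap-map; length-replicate; ++-assoc; ++-identityʳ)
open import Data.List.Relation.Unary.All as All using ()
open import Data.List.Relation.Unary.AllPairs using (_∷_)
open import Data.List.Relation.Unary.Any using (here; there)
open import Data.List.Relation.Unary.Unique.DecPropositional.Properties using (deduplicate-!)
open import Data.List.Relation.Unary.Unique.Propositional using (Unique)
import Data.List.Relation.Unary.Unique.Propositional.Properties as Unique
open import Data.Nat.Base
open import Data.Nat.DivMod using (m<n*o⇒m/o<n; m%n<n; m<n⇒m%n≡m; [m+kn]%n≡m%n;
  m≡m%n+[m/n]*n)
open import Data.Nat.Induction using (<-wellFounded)
open import Data.Nat.Properties
open import Data.Nat.Tactic.RingSolver using (solve-∀)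
open import Data.Product.Base using (_,_; _×_; proj₁; proj₂; ∃; ∃₂)
open import Data.Sum.Base using (inj₁; inj₂; _⊎_)
open import Data.Vec.Base using (Vec; []; _∷_; lookup; toList; tabulate)
open import Data.Vec.Properties using (lookup∘tabulate; lookup⇒[]=; []=⇒lookup; length-toList)
  renaming (≡-dec to Vec-≡-dec)
open import Function.Base using (_∘_; id)
open import Function.Bundles using (Equivalence)
open import Induction.WellFounded using (Acc; acc)
open import Level using (0ℓ)
open import Relation.Binary.Definitions using (tri<; tri≈; tri>)
open import Relation.Binary.PropositionalEquality hiding ([_])
open import Relation.Nullary using (¬_; Dec; yes; no; does; contradiction)
open import Relation.Nullary.Decidable using (map′; _×-dec_; dec-true)
open import Relation.Unary using (Pred; Decidable)
open import Defs

-- Counting in lists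

-- Pigeonhole principle: the partner of the head is deleted from `ys`, and by injectivity no later
-- element needs it. A relation replaces a function so that it can carry facts that injectivity
-- uses.
injective-length : ∀ {A B : Set} {R : A → B → Set} →
  (∀ {x x′ y} → R x y → R x′ y → x ≡ x′) →
  ∀ {xs ys} → Unique xs → (∀ {x} → x ∈ xs → ∃ λ y → y ∈ ys × R x y) →
  length xs ≤ length ys
injective-length inj {[]} _ _ = z≤n
injective-length {R = R} inj {x ∷ xs} (x∉ ∷ u) total
  with y , y∈ , Rxy ← total (here refl)
  with as , bs , refl ← ∈-∃++ y∈ = begin
    suc (length xs)              ≤⟨ s≤s (injective-length inj u total′) ⟩
    suc (length (as ++ bs))      ≡⟨ cong suc (length-++ as) ⟩
    suc (length as + length bs)  ≡⟨ +-suc _ _ ⟨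
    length as + suc (length bs)  ≡⟨ length-++ as ⟨
    length (as ++ y ∷ bs)        ∎
  where
  open ≤-Reasoning
  total′ : ∀ {x′} → x′ ∈ xs → ∃ λ y′ → y′ ∈ as ++ bs × R x′ y′
  total′ x′∈ with total (there x′∈)
  ... | y′ , y′∈ , Rx′y′ with ∈-++⁻ as y′∈
  ... | inj₁ ∈as         = y′ , ∈-++⁺ˡ ∈as , Rx′y′
  ... | inj₂ (there ∈bs) = y′ , ∈-++⁺ʳ as ∈bs , Rx′y′
  -- A shared partner would make `x′` a second copy of `x`, against uniqueness.
  ... | inj₂ (here refl) = contradiction (inj Rxy Rx′y′) (All.lookup x∉ x′∈)

unique-⊆-length : ∀ {A : Set} {xs ys : List A} → Unique xs → (∀ {x} → x ∈ xs → x ∈ ys) →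
  length xs ≤ length ys
unique-⊆-length u ⊆ = injective-length {R = _≡_} (λ eq eq′ → trans eq (sym eq′)) u
  (λ {x} x∈ → x , ⊆ x∈ , refl)

length-filter-map : ∀ {A B : Set} {P : Pred B 0ℓ} (P? : Decidable P) (f : A → B) xs →
  length (filter P? (map f xs)) ≡ length (filter (P? ∘ f) xs)
length-filter-map P? f []       = refl
length-filter-map P? f (x ∷ xs) with does (P? (f x))
... | true  = cong suc (length-filter-map P? f xs)
... | false = length-filter-map P? f xs

-- Möbius inversion over supersets

#⊇ #≡ : ∀ {n} → Subset n → List (Subset n) → ℕ
#⊇ T xs = length (filter (T ⊆?_) xs)
#≡ T xs = length (filter (λ U → Vec-≡-dec _≟ᵇ_ U T) xs)

tailsIn tailsOut : ∀ {n} → List (Subset (suc n)) → List (Subset n)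
tailsIn []                   = []
tailsIn ((inside  ∷ U) ∷ xs) = U ∷ tailsIn xs
tailsIn ((outside ∷ U) ∷ xs) = tailsIn xs
tailsOut []                   = []
tailsOut ((inside  ∷ U) ∷ xs) = tailsOut xs
tailsOut ((outside ∷ U) ∷ xs) = U ∷ tailsOut xs

#⊇-inside : ∀ {n} (T : Subset n) xs → #⊇ (inside ∷ T) xs ≡ #⊇ T (tailsIn xs)
#⊇-inside T []                   = refl
#⊇-inside T ((inside  ∷ U) ∷ xs) with does (T ⊆? U)
... | true  = cong suc (#⊇-inside T xs)
... | false = #⊇-inside T xs
#⊇-inside T ((outside ∷ U) ∷ xs) = #⊇-inside T xs

#⊇-outside : ∀ {n} (T : Subset n) xs →
  #⊇ (outside ∷ T) xs ≡ #⊇ T (tailsIn xs) + #⊇ T (tailsOut xs)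
#⊇-outside T []                   = refl
#⊇-outside T ((inside  ∷ U) ∷ xs) with does (T ⊆? U)
... | true  = cong suc (#⊇-outside T xs)
... | false = #⊇-outside T xs
#⊇-outside T ((outside ∷ U) ∷ xs) with does (T ⊆? U)
... | true  = trans (cong suc (#⊇-outside T xs)) (sym (+-suc _ _))
... | false = #⊇-outside T xs

#≡-inside : ∀ {n} (T : Subset n) xs → #≡ (inside ∷ T) xs ≡ #≡ T (tailsIn xs)
#≡-inside T []                   = refl
#≡-inside T ((inside  ∷ U) ∷ xs) with does (Vec-≡-dec _≟ᵇ_ U T)
... | true  = cong suc (#≡-inside T xs)
... | false = #≡-inside T xs
#≡-inside T ((outside ∷ U) ∷ xs) = #≡-inside T xs

#≡-outside : ∀ {n} (T : Subset n) xs → #≡ (outside ∷ T) xs ≡ #≡ T (tailsOut xs)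
#≡-outside T []                   = refl
#≡-outside T ((outside ∷ U) ∷ xs) with does (Vec-≡-dec _≟ᵇ_ U T)
... | true  = cong suc (#≡-outside T xs)
... | false = #≡-outside T xs
#≡-outside T ((inside  ∷ U) ∷ xs) = #≡-outside T xs

-- Inversion one coordinate at a time: the supersets of `outside ∷ T` are those with first
-- coordinate `inside` and those with `outside`. The former are counted by `inside ∷ T`, so
-- subtraction isolates the latter, and induction applies to each list of tails.
möbius : ∀ n (xs ys : List (Subset n)) → (∀ T → #⊇ T xs ≡ #⊇ T ys) → ∀ T → #≡ T xs ≡ #≡ T ys
möbius zero xs ys h [] = trans (sym (agree xs)) (trans (h []) (agree ys))
  where
  agree : ∀ zs → #⊇ [] zs ≡ #≡ [] zs
  agree []        = refl
  agree ([] ∷ zs) = cong suc (agree zs)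
möbius (suc n) xs ys h = λ
  { (inside  ∷ T) → trans (#≡-inside T xs)
      (trans (möbius n (tailsIn xs) (tailsIn ys) hIn T) (sym (#≡-inside T ys)))
  ; (outside ∷ T) → trans (#≡-outside T xs)
      (trans (möbius n (tailsOut xs) (tailsOut ys) hOut T) (sym (#≡-outside T ys)))
  }
  where
  open ≡-Reasoning
  hIn : ∀ T → #⊇ T (tailsIn xs) ≡ #⊇ T (tailsIn ys)
  hIn T = trans (sym (#⊇-inside T xs)) (trans (h (inside ∷ T)) (#⊇-inside T ys))
  hOut : ∀ T → #⊇ T (tailsOut xs) ≡ #⊇ T (tailsOut ys)
  hOut T = +-cancelˡ-≡ (#⊇ T (tailsIn xs)) _ _ (begin
    #⊇ T (tailsIn xs) + #⊇ T (tailsOut xs)  ≡⟨ #⊇-outside T xs ⟨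
    #⊇ (outside ∷ T) xs                     ≡⟨ h (outside ∷ T) ⟩
    #⊇ (outside ∷ T) ys                     ≡⟨ #⊇-outside T ys ⟩
    #⊇ T (tailsIn ys) + #⊇ T (tailsOut ys)  ≡⟨ cong (_+ _) (hIn T) ⟨
    #⊇ T (tailsIn xs) + #⊇ T (tailsOut ys)  ∎)

-- Letters of a word by position

-- Junk value: nth xs i = 0 when i ≥ length xs.
nth : List ℕ → ℕ → ℕ
nth []       _       = 0
nth (x ∷ xs) zero    = x
nth (x ∷ xs) (suc i) = nth xs i

nth-ext : ∀ {xs ys} → length xs ≡ length ys → (∀ i → i < length xs → nth xs i ≡ nth ys i) →
  xs ≡ ys
nth-ext {[]}     {[]}     _  _ = refl
nth-ext {x ∷ xs} {y ∷ ys} eq h =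
  cong₂ _∷_ (h 0 z<s) (nth-ext (suc-injective eq) (λ i i< → h (suc i) (s<s i<)))

nth-++ˡ : ∀ xs {ys i} → i < length xs → nth (xs ++ ys) i ≡ nth xs i
nth-++ˡ (x ∷ xs) {i = zero}  _        = refl
nth-++ˡ (x ∷ xs) {i = suc i} (s<s i<) = nth-++ˡ xs i<

nth-++ʳ : ∀ xs {ys} i → nth (xs ++ ys) (length xs + i) ≡ nth ys i
nth-++ʳ []       i = refl
nth-++ʳ (x ∷ xs) i = nth-++ʳ xs i

nth-replicate : ∀ {n i x} → i < n → nth (replicate n x) i ≡ x
nth-replicate {suc n} {zero}  _        = refl
nth-replicate {suc n} {suc i} (s<s i<) = nth-replicate i<

nth-drop : ∀ k xs i → nth (drop k xs) i ≡ nth xs (k + i)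
nth-drop zero    xs       i = refl
nth-drop (suc k) []       i = refl
nth-drop (suc k) (x ∷ xs) i = nth-drop k xs i

nth-take : ∀ {k} xs {i} → i < k → nth (take k xs) i ≡ nth xs i
nth-take {suc k} []       {i}     _        = refl
nth-take {suc k} (x ∷ xs) {zero}  _        = refl
nth-take {suc k} (x ∷ xs) {suc i} (s<s i<) = nth-take xs i<

nth-map : ∀ (f : ℕ → ℕ) xs {i} → i < length xs → nth (map f xs) i ≡ f (nth xs i)
nth-map f (x ∷ xs) {zero}  _        = refl
nth-map f (x ∷ xs) {suc i} (s<s i<) = nth-map f xs i<

nth-∈ : ∀ xs {i} → i < length xs → nth xs i ∈ xs
nth-∈ (x ∷ xs) {zero}  _        = here refl
nth-∈ (x ∷ xs) {suc i} (s<s i<) = there (nth-∈ xs i<)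

∈-nth : ∀ {xs x} → x ∈ xs → ∃ λ i → i < length xs × nth xs i ≡ x
∈-nth (here refl) = 0 , z<s , refl
∈-nth (there x∈) with i , i< , eq ← ∈-nth x∈ = suc i , s<s i< , eq

-- Reduction

lettersBelow : List ℕ → ℕ → List ℕ
lettersBelow w x = filter (_<? x) (deduplicate _≟_ w)

lettersBelow-unique : ∀ w x → Unique (lettersBelow w x)
lettersBelow-unique w x = Unique.filter⁺ (_<? x) (deduplicate-! _≟_ w)

∈-lettersBelow⁺ : ∀ {w x y} → y ∈ w → y < x → y ∈ lettersBelow w x
∈-lettersBelow⁺ y∈ y< = ∈-filter⁺ (_<? _) (∈-deduplicate⁺ _≟_ y∈) y<

∈-lettersBelow⁻ : ∀ w {x y} → y ∈ lettersBelow w x → y ∈ w × y < x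
∈-lettersBelow⁻ w y∈ with y∈′ , y< ← ∈-filter⁻ (_<? _) {xs = deduplicate _≟_ w} y∈ =
  ∈-deduplicate⁻ _≟_ w y∈′ , y<

-- `reduction w` is by definition `map (rank w) w`, so reductions are studied through the order
-- properties of `rank w`.
rank : List ℕ → ℕ → ℕ
rank w x = length (lettersBelow w x)

rank-mono-≤ : ∀ w {x y} → x ≤ y → rank w x ≤ rank w y
rank-mono-≤ w x≤y = unique-⊆-length (lettersBelow-unique w _) λ z∈ →
  let z∈w , z<x = ∈-lettersBelow⁻ w z∈ in ∈-lettersBelow⁺ z∈w (<-≤-trans z<x x≤y)

rank-mono-< : ∀ {w x y} → x ∈ w → x < y → rank w x < rank w y
rank-mono-< {w} {x} x∈ x<y = unique-⊆-length
  (All.tabulate (λ { z∈ refl → <-irrefl refl (proj₂ (∈-lettersBelow⁻ w z∈)) })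
    ∷ lettersBelow-unique w x)
  λ { (here refl) → ∈-lettersBelow⁺ x∈ x<y
    ; (there z∈) → let z∈w , z<x = ∈-lettersBelow⁻ w z∈ in
        ∈-lettersBelow⁺ z∈w (<-trans z<x x<y) }

rank-cancel-< : ∀ w {x y} → rank w x < rank w y → x < y
rank-cancel-< w r< = ≰⇒> λ y≤x → <⇒≱ r< (rank-mono-≤ w y≤x)

rank-injective : ∀ {w x y} → x ∈ w → y ∈ w → rank w x ≡ rank w y → x ≡ y
rank-injective {w} {x} {y} x∈ y∈ eq with <-cmp x y
... | tri< x<y _ _ = contradiction eq (<⇒≢ (rank-mono-< x∈ x<y))
... | tri≈ _ x≡y _ = x≡y
... | tri> _ _ y<x = contradiction (sym eq) (<⇒≢ (rank-mono-< y∈ y<x))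

-- The letters of `w` below `f v` are exactly the values of `f` at the arguments below `v`; the two
-- inequalities count the two inclusions.
rank-increasing : ∀ {w s} {f : ℕ → ℕ} → (∀ {u v} → u < v → v ≤ s → f u < f v) →
  (∀ {x} → x ∈ w → ∃ λ u → u ≤ s × x ≡ f u) → (∀ {u} → u ≤ s → f u ∈ w) →
  ∀ {v} → v ≤ s → rank w (f v) ≡ v
rank-increasing {w} {s} {f} incr letters attained {v} v≤s = ≤-antisym
  (begin
    rank w (f v)           ≤⟨ unique-⊆-length (lettersBelow-unique w _) below ⟩
    length (map f (upTo v)) ≡⟨ length-map f (upTo v) ⟩
    length (upTo v)         ≡⟨ length-upTo v ⟩
    v                       ∎)
  (begin
    v                       ≡⟨ length-upTo v ⟨
    length (upTo v)         ≤⟨ injective-length {R = λ u x → u ≤ s × x ≡ f u} f-injective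
                                (Unique.upTo⁺ v) above ⟩
    rank w (f v)            ∎)
  where
  open ≤-Reasoning
  f-injective : ∀ {u u′ x} → u ≤ s × x ≡ f u → u′ ≤ s × x ≡ f u′ → u ≡ u′
  f-injective {u} {u′} (u≤ , eq) (u′≤ , eq′) with <-cmp u u′
  ... | tri< u< _ _ = contradiction (trans (sym eq) eq′) (<⇒≢ (incr u< u′≤))
  ... | tri≈ _ u≡ _ = u≡
  ... | tri> _ _ u> = contradiction (trans (sym eq′) eq) (<⇒≢ (incr u> u≤))
  below : ∀ {x} → x ∈ lettersBelow w (f v) → x ∈ map f (upTo v)
  below x∈ with x∈w , x< ← ∈-lettersBelow⁻ w x∈ with letters x∈w
  ... | u , u≤ , refl = ∈-map⁺ f (∈-upTo⁺ (≰⇒> λ v≤u → <⇒≱ x<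
          (monotone v≤u u≤)))
    where
    monotone : ∀ {u v} → u ≤ v → v ≤ s → f u ≤ f v
    monotone {u} {v} u≤v v≤s with m≤n⇒m<n∨m≡n u≤v
    ... | inj₁ u<v  = <⇒≤ (incr u<v v≤s)
    ... | inj₂ refl = ≤-refl
  above : ∀ {u} → u ∈ upTo v → ∃ λ x → x ∈ lettersBelow w (f v) × u ≤ s × x ≡ f u
  above u∈ with u<v ← ∈-upTo⁻ u∈ with u≤s ← ≤-trans (<⇒≤ u<v) v≤s =
    _ , ∈-lettersBelow⁺ (attained u≤s) (incr u<v v≤s) , u≤s , refl

-- Words cut into blocks of equal length

cell-bound : ∀ {q s a b} → a < s → b < q → a * q + b < s * q
cell-bound {q} {s} {a} {b} a<s b<q = begin-strict
  a * q + b  <⟨ +-monoʳ-< (a * q) b<q ⟩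
  a * q + q  ≡⟨ +-comm (a * q) q ⟩
  suc a * q  ≤⟨ *-monoˡ-≤ q a<s ⟩
  s * q      ∎
  where open ≤-Reasoning

cell-of : ∀ q s i → i < s * suc q → ∃₂ λ a b → a < s × b < suc q × i ≡ a * suc q + b
cell-of q s i i< =
  i / suc q , i % suc q ,
  m<n*o⇒m/o<n i< , m%n<n i (suc q) ,
  trans (m≡m%n+[m/n]*n i (suc q)) (+-comm (i % suc q) _)

module _ {A : Set} {q : ℕ} {f : A → List ℕ} (length-f : ∀ x → length (f x) ≡ q) where

  length-concatMap : ∀ xs → length (concatMap f xs) ≡ length xs * q
  length-concatMap []       = refl
  length-concatMap (x ∷ xs) =
    trans (length-++ (f x)) (cong₂ _+_ (length-f x) (length-concatMap xs))

  nth-concatMap-∷ : ∀ x xs a b →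
    nth (concatMap f (x ∷ xs)) (suc a * q + b) ≡ nth (concatMap f xs) (a * q + b)
  nth-concatMap-∷ x xs a b = begin
    nth (f x ++ concatMap f xs) (q + a * q + b)
      ≡⟨ cong (nth (f x ++ concatMap f xs)) (+-assoc q (a * q) b) ⟩
    nth (f x ++ concatMap f xs) (q + (a * q + b))
      ≡⟨ cong (λ l → nth (f x ++ concatMap f xs) (l + (a * q + b))) (length-f x) ⟨
    nth (f x ++ concatMap f xs) (length (f x) + (a * q + b)) ≡⟨ nth-++ʳ (f x) (a * q + b) ⟩
    nth (concatMap f xs) (a * q + b)                         ∎
    where open ≡-Reasoning

nth-concatMap : ∀ {q} {f : ℕ → List ℕ} → (∀ x → length (f x) ≡ q) →
  ∀ xs {a b} → a < length xs → b < q → nth (concatMap f xs) (a * q + b) ≡ nth (f (nth xs a)) b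
nth-concatMap {f = f} length-f (x ∷ xs) {zero}  {b} _        b<q =
  nth-++ˡ (f x) (subst (b <_) (sym (length-f x)) b<q)
nth-concatMap {f = f} length-f (x ∷ xs) {suc a} {b} (s<s a<) b<q =
  trans (nth-concatMap-∷ {f = f} length-f x xs a b) (nth-concatMap {f = f} length-f xs a< b<q)

nth-downFrom : ∀ {s a} → a < s → nth (downFrom s) a ≡ s ∸ suc a
nth-downFrom {suc s} {zero}  _        = refl
nth-downFrom {suc s} {suc a} (s<s a<) = nth-downFrom a<

-- Occurrences

-- A pattern with the s + 1 letters 0, …, s whose block a has at cell b the letter s ∸ level a b.
-- Cell (block k, cell k) is one of level k.
record Shape (r s : ℕ) : Set where
  field
    level     : ℕ → ℕ → ℕ
    level≤s   : ∀ {a b} → a < s → b ≤ r → level a b ≤ s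
    block     : ℕ → ℕ
    cell      : ℕ → ℕ
    block<s   : ∀ {k} → k ≤ s → block k < s
    cell≤r    : ∀ {k} → k ≤ s → cell k ≤ r
    level-at  : ∀ {k} → k ≤ s → level (block k) (cell k) ≡ k

  record Spelt (p : List ℕ) : Set where
    field
      length-p : length p ≡ s * suc r
      letter   : ∀ {a b} → a < s → b ≤ r → nth p (a * suc r + b) ≡ s ∸ level a b

  -- `y k` is the value taken by the pattern letter `s ∸ k`. Levels number the letters from the
  -- largest down, hence `y` decreases.
  record Occurs (e : ℕ → ℕ) (t : ℕ) : Set where
    field
      y      : ℕ → ℕ
      y-anti : ∀ {k} → k < s → y (suc k) < y k
      values : ∀ {a b} → a < s → b ≤ r → e (t + a * suc r + b) ≡ y (level a b)

    y-anti* : ∀ {j k} → j < k → k ≤ s → y k < y j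
    y-anti* {j} {suc k} (s≤s j≤k) k<s with m≤n⇒m<n∨m≡n j≤k
    ... | inj₁ j<k  = <-trans (y-anti k<s) (y-anti* j<k (<⇒≤ k<s))
    ... | inj₂ refl = y-anti k<s

  module _ {p : List ℕ} (spelt : Spelt p) (0<s : 0 < s) where
    open Spelt spelt

    private
      q = suc r
      m = s * q

      0<m : 0 < m
      0<m = *-mono-≤ 0<s (s≤s z≤n)

      position<m : ∀ {a b} → a < s → b ≤ r → a * q + b < m
      position<m a<s b≤r = cell-bound a<s (s≤s b≤r)

    module _ (l : List ℕ) (t : ℕ) where
      private
        w = take (length p) (drop t l)

        nth-w : ∀ {a b} → a < s → b ≤ r → nth w (a * q + b) ≡ nth l (t + a * q + b)
        nth-w {a} {b} a<s b≤r = begin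
          nth w (a * q + b)
            ≡⟨ nth-take (drop t l) (subst (a * q + b <_) (sym length-p) (position<m a<s b≤r)) ⟩
          nth (drop t l) (a * q + b)  ≡⟨ nth-drop t l _ ⟩
          nth l (t + (a * q + b))     ≡⟨ cong (nth l) (+-assoc t (a * q) b) ⟨
          nth l (t + a * q + b)       ∎
          where open ≡-Reasoning

      module _ (red : reduction w ≡ p) where
        private
          length-w : length w ≡ m
          length-w = trans (sym (length-map _ w)) (trans (cong length red) length-p)

          t+m≤length-l : t + m ≤ length l
          t+m≤length-l = begin
            t + m               ≤⟨ +-monoʳ-≤ t m≤ ⟩
            t + (length l ∸ t)  ≡⟨ m+[n∸m]≡n t≤ ⟩
            length l            ∎
            where
            open ≤-Reasoning
            m≤ : m ≤ length l ∸ t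
            m≤ = begin
              m                                ≡⟨ length-w ⟨
              length w                         ≡⟨ length-take (length p) (drop t l) ⟩
              length p ⊓ length (drop t l)     ≤⟨ m⊓n≤n (length p) _ ⟩
              length (drop t l)                ≡⟨ length-drop t l ⟩
              length l ∸ t                     ∎
            t≤ : t ≤ length l
            -- Beyond the end of `l` the truncated difference is 0, too small for the positive
            -- length `m`.
            t≤ = <⇒≤ (m∸n≢0⇒n<m λ eq → <⇒≱ 0<m (subst (m ≤_) eq m≤))

          ∈w : ∀ {a b} → a < s → b ≤ r → nth w (a * q + b) ∈ w
          ∈w a<s b≤r = nth-∈ w (subst (_ <_) (sym length-w) (position<m a<s b≤r))

          rank-w : ∀ {a b} → a < s → b ≤ r → rank w (nth w (a * q + b)) ≡ s ∸ level a b
          rank-w {a} {b} a<s b≤r = begin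
            rank w (nth w (a * q + b))
              ≡⟨ nth-map (rank w) w (subst (_ <_) (sym length-w) (position<m a<s b≤r)) ⟨
            nth (reduction w) (a * q + b)  ≡⟨ cong (λ v → nth v (a * q + b)) red ⟩
            nth p (a * q + b)              ≡⟨ letter a<s b≤r ⟩
            s ∸ level a b                  ∎
            where open ≡-Reasoning

          y : ℕ → ℕ
          y k = nth w (block k * q + cell k)

          rank-y : ∀ {k} → k ≤ s → rank w (y k) ≡ s ∸ k
          rank-y k≤s = trans (rank-w (block<s k≤s) (cell≤r k≤s)) (cong (s ∸_) (level-at k≤s))

        -- The value of level `k` is read at its representative cell. Letters of `w` are ordered and
        -- told apart by their ranks, which `red` identifies with the letters of `p`; the length of
        -- `p` shows that the factor was not cut off.
        reduction⇒occurs : t + m ≤ length l × Occurs (nth l) t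
        reduction⇒occurs = t+m≤length-l , record
          { y = y
          ; y-anti = λ {k} k<s → rank-cancel-< w (subst₂ _<_ (sym (rank-y k<s))
              (sym (rank-y (<⇒≤ k<s))) (∸-monoʳ-< (n<1+n k) k<s))
          ; values = λ a<s b≤r → let ℓ≤s = level≤s a<s b≤r in
              trans (sym (nth-w a<s b≤r))
                (rank-injective {w} (∈w a<s b≤r) (∈w (block<s ℓ≤s) (cell≤r ℓ≤s))
                  (trans (rank-w a<s b≤r) (sym (rank-y ℓ≤s))))
          }

      module _ (t+m≤ : t + m ≤ length l) (occ : Occurs (nth l) t) where
        open Occurs occ
        private
          length-w : length w ≡ m
          length-w = begin
            length w                      ≡⟨ length-take (length p) (drop t l) ⟩
            length p ⊓ length (drop t l)  ≡⟨ cong₂ _⊓_ length-p (length-drop t l) ⟩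
            m ⊓ (length l ∸ t)
              ≡⟨ m≤n⇒m⊓n≡m (m+n≤o⇒m≤o∸n m (subst (_≤ length l) (+-comm t m) t+m≤)) ⟩
            m                             ∎
            where open ≡-Reasoning

          -- Reversing the levels lists the letters of `w` in increasing order, as `rank-increasing`
          -- requires.
          f : ℕ → ℕ
          f v = y (s ∸ v)

          f-incr : ∀ {u v} → u < v → v ≤ s → f u < f v
          f-incr {u} u<v v≤s = y-anti* (∸-monoʳ-< u<v v≤s) (m∸n≤m s u)

          w-letter : ∀ {a b} → a < s → b ≤ r → nth w (a * q + b) ≡ f (s ∸ level a b)
          w-letter a<s b≤r = trans (nth-w a<s b≤r)
            (trans (values a<s b≤r) (cong y (sym (m∸[m∸n]≡n (level≤s a<s b≤r)))))

          letters : ∀ {x} → x ∈ w → ∃ λ u → u ≤ s × x ≡ f u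
          letters x∈ with i , i< , refl ← ∈-nth x∈
            with a , b , a<s , s≤s b≤r , refl ← cell-of r s i (subst (i <_) length-w i<) =
            s ∸ level a b , m∸n≤m s (level a b) , w-letter a<s b≤r

          attained : ∀ {u} → u ≤ s → f u ∈ w
          attained {u} u≤s = subst (_∈ w)
            (trans (w-letter (block<s k≤s) (cell≤r k≤s))
              (cong f (trans (cong (s ∸_) (level-at k≤s)) (m∸[m∸n]≡n u≤s))))
            (nth-∈ w (subst (_ <_) (sym length-w) (position<m (block<s k≤s) (cell≤r k≤s))))
            where k≤s = m∸n≤m s u

        -- All `s + 1` values occur in `w`, since every level has a representative cell; so the rank
        -- of a letter is its index in increasing order.
        occurs⇒reduction : reduction w ≡ p
        occurs⇒reduction = nth-ext (trans (length-map _ w) (trans length-w (sym length-p))) same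
          where
          open ≡-Reasoning
          same : ∀ i → i < length (reduction w) → nth (reduction w) i ≡ nth p i
          same i i< with i<m ← subst (i <_) (trans (length-map _ w) length-w) i<
            with a , b , a<s , s≤s b≤r , refl ← cell-of r s i i<m = begin
            nth (reduction w) i            ≡⟨ nth-map (rank w) w (subst (i <_) (sym length-w) i<m) ⟩
            rank w (nth w i)               ≡⟨ cong (rank w) (w-letter a<s b≤r) ⟩
            rank w (f (s ∸ level a b))     ≡⟨ rank-increasing f-incr letters attained (m∸n≤m s (level a b)) ⟩
            s ∸ level a b                  ≡⟨ letter a<s b≤r ⟨
            nth p i                        ∎

-- The three shapes

module _ (r s : ℕ) (0<r : 0 < r) (0<s : 0 < s) where
  level₁ level₂ level₃ : ℕ → ℕ → ℕ
  level₁ a zero    = a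
  level₁ a (suc b) = s
  level₂ a zero    = 0
  level₂ a (suc b) = suc a
  level₃ a zero    = a
  level₃ a (suc b) = suc a

  shape₁ : Shape r s
  shape₁ = record
    { level    = level₁
    ; level≤s  = λ { {b = zero} a<s _ → <⇒≤ a<s ; {b = suc b} _ _ → ≤-refl }
    -- Levels below `s` are found at cell 0 of their own block, level `s` at cell 1 of the last
    -- block; minimum and truncated subtraction cover both cases.
    ; block    = λ k → k ⊓ pred s
    ; cell     = λ k → k ∸ pred s
    ; block<s  = λ {k} _ → ≤-<-trans (m⊓n≤n k (pred s)) pred-s<s
    ; cell≤r   = λ {k} k≤s → ≤-trans (∸-monoˡ-≤ (pred s) k≤s) (≤-trans (≤-reflexive s∸pred-s) 0<r)
    ; level-at = λ {k} → level-at k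
    }
    where
    suc-pred-s : suc (pred s) ≡ s
    suc-pred-s = suc-pred s {{>-nonZero 0<s}}
    pred-s<s : pred s < s
    pred-s<s = ≤-reflexive suc-pred-s
    s∸pred-s : s ∸ pred s ≡ 1
    s∸pred-s = trans (cong (_∸ pred s) (sym suc-pred-s)) (m+n∸n≡m 1 (pred s))
    level-at : ∀ k → k ≤ s → level₁ (k ⊓ pred s) (k ∸ pred s) ≡ k
    level-at k k≤s with m≤n⇒m<n∨m≡n k≤s
    ... | inj₂ refl rewrite s∸pred-s = refl
    ... | inj₁ k<s rewrite m≤n⇒m∸n≡0 (<⇒≤pred k<s) = m≤n⇒m⊓n≡m (<⇒≤pred k<s)

  shape₂ : Shape r s
  shape₂ = record
    { level    = level₂
    ; level≤s  = λ { {b = zero} _ _ → z≤n ; {b = suc b} a<s _ → a<s }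
    ; block    = pred
    ; cell     = λ { zero → 0 ; (suc _) → 1 }
    ; block<s  = λ { {zero} _ → 0<s ; {suc k} k<s → k<s }
    ; cell≤r   = λ { {zero} _ → z≤n ; {suc _} _ → 0<r }
    ; level-at = λ { {zero} _ → refl ; {suc _} _ → refl }
    }

  shape₃ : Shape r s
  shape₃ = record
    { level    = level₃
    ; level≤s  = λ { {b = zero} a<s _ → <⇒≤ a<s ; {b = suc b} a<s _ → a<s }
    ; block    = pred
    ; cell     = λ { zero → 0 ; (suc _) → 1 }
    ; block<s  = λ { {zero} _ → 0<s ; {suc k} k<s → k<s }
    ; cell≤r   = λ { {zero} _ → z≤n ; {suc _} _ → 0<r }
    ; level-at = λ { {zero} _ → refl ; {suc _} _ → refl }
    }

  private
    length-block : ∀ (x i : ℕ) → length (x ∷ replicate r i) ≡ suc r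
    length-block x i = cong suc (length-replicate r)

    -- The index `i` runs downwards, so block `a` is the one with `i = s ∸ suc a`.
    spelt-blocks : ∀ (S : Shape r s) (g h : ℕ → ℕ) →
      (∀ {a} → a < s → g (s ∸ suc a) ≡ s ∸ Shape.level S a 0) →
      (∀ {a b} → a < s → h (s ∸ suc a) ≡ s ∸ Shape.level S a (suc b)) →
      Shape.Spelt S (concatMap (λ i → g i ∷ replicate r (h i)) (downFrom s))
    spelt-blocks S g h first rest = record
      { length-p = trans
          (length-concatMap {f = blockOf} (λ i → length-block (g i) (h i)) (downFrom s))
          (cong (_* suc r) (length-downFrom s))
      ; letter = λ {a} {b} a<s b≤r → trans
          (nth-concatMap {f = blockOf} (λ i → length-block (g i) (h i)) (downFrom s)
            (subst (a <_) (sym (length-downFrom s)) a<s) (s≤s b≤r))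
          (trans (cong (λ i → nth (g i ∷ replicate r (h i)) b) (nth-downFrom a<s))
            (in-block a<s b≤r))
      }
      where
      blockOf : ℕ → List ℕ
      blockOf i = g i ∷ replicate r (h i)
      in-block : ∀ {a b} → a < s → b ≤ r →
        nth (g (s ∸ suc a) ∷ replicate r (h (s ∸ suc a))) b ≡ s ∸ Shape.level S a b
      in-block {b = zero}  a<s _   = first a<s
      in-block {b = suc b} a<s b<r = trans (nth-replicate b<r) (rest a<s)

    suc-∸-suc : ∀ {a} → a < s → suc (s ∸ suc a) ≡ s ∸ a
    suc-∸-suc a<s = sym (+-∸-assoc 1 a<s)

    -- `Q₃` is defined with blocks that end in the letter opening the next row. Moving every cut one
    -- letter to the left turns them into a letter followed by `r` equal ones, as in the other
    -- patterns. The first letter `x` is arbitrary for the induction.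
    regroup : ∀ x j →
      x ∷ concatMap (λ i → replicate r i ++ [ i ]) (map suc (downFrom j)) ++ replicate r 0 ≡
      (x ∷ replicate r j) ++ concatMap (λ i → suc i ∷ replicate r i) (downFrom j)
    regroup x zero    = cong (x ∷_) (sym (++-identityʳ _))
    regroup x (suc j) = cong (x ∷_) (trans
      (cong (_++ replicate r 0) (++-assoc (replicate r (suc j)) [ suc j ] _))
      (trans (++-assoc (replicate r (suc j)) _ (replicate r 0))
        (cong (replicate r (suc j) ++_) (regroup (suc j) j))))

  spelt₁ : Shape.Spelt shape₁ (Q₁ r s)
  spelt₁ = subst (Shape.Spelt shape₁)
    (sym (concatMap-map (λ i → i ∷ replicate r 0) suc (downFrom s)))
    (spelt-blocks shape₁ suc (λ _ → 0) suc-∸-suc (λ _ → sym (n∸n≡0 s)))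

  spelt₂ : Shape.Spelt shape₂ (Q₂ r s)
  spelt₂ = spelt-blocks shape₂ (λ _ → s) (λ i → i) (λ _ → refl) (λ _ → refl)

  spelt₃ : Shape.Spelt shape₃ (Q₃ r s)
  spelt₃ = subst (Shape.Spelt shape₃) (sym (regrouped 0<s))
    (spelt-blocks shape₃ suc (λ i → i) suc-∸-suc (λ _ → refl))
    where
    regrouped : ∀ {s} → 0 < s → Q₃ r s ≡ concatMap (λ i → suc i ∷ replicate r i) (downFrom s)
    regrouped {suc s′} _ = regroup (suc s′) s′

-- Both cells are the residue of the same number modulo `q`.
cell-unique : ∀ {q} a a′ {b b′} → b < q → b′ < q → a * q + b ≡ a′ * q + b′ → b ≡ b′
cell-unique {suc r} a a′ {b} {b′} b<q b′<q eq = begin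
  b                            ≡⟨ m<n⇒m%n≡m b<q ⟨
  b % suc r                    ≡⟨ [m+kn]%n≡m%n b a (suc r) ⟨
  (b + a * suc r) % suc r      ≡⟨ cong (_% suc r) (+-comm b (a * suc r)) ⟩
  (a * suc r + b) % suc r      ≡⟨ cong (_% suc r) eq ⟩
  (a′ * suc r + b′) % suc r    ≡⟨ cong (_% suc r) (+-comm (a′ * suc r) b′) ⟩
  (b′ + a′ * suc r) % suc r    ≡⟨ [m+kn]%n≡m%n b′ a′ (suc r) ⟩
  b′ % suc r                   ≡⟨ m<n⇒m%n≡m b′<q ⟩
  b′                           ∎
  where open ≡-Reasoning

-- Redefining a function on a decidable set by following σ until the set is left

module Fill {Z : ℕ → Set} (Z? : ∀ i → Dec (Z i)) (σ : ∀ {i} → Z i → ℕ)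
  (μ : ℕ → ℕ) (decreasing : ∀ {i} (z : Z i) → μ (σ z) < μ i) where

  step : ℕ → ℕ
  step i with Z? i
  ... | yes z = σ z
  ... | no  _ = i

  -- The first argument is fuel. As `μ` decreases along `σ`, fuel `μ i` suffices to leave `Z` from
  -- `i`, and more changes nothing.
  root : ℕ → ℕ → ℕ
  root zero    i = i
  root (suc k) i = root k (step i)

  root-fixed : ∀ k {i} → step i ≡ i → root k i ≡ i
  root-fixed zero    eq = refl
  root-fixed (suc k) eq = trans (cong (root k) eq) (root-fixed k eq)

  root-off : ∀ k {i} → ¬ Z i → root k i ≡ i
  root-off k {i} ¬z = root-fixed k fixed
    where
    fixed : step i ≡ i
    fixed with Z? i
    ... | yes z = contradiction z ¬z
    ... | no  _ = refl

  root-step : ∀ k {i} → μ i ≤ k → root k (step i) ≡ root k i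
  root-step zero {i} μ≤ with Z? i
  ... | yes z = contradiction (≤-trans (decreasing z) μ≤) (λ ())
  ... | no  _ = refl
  root-step (suc k) {i} μ≤ with Z? i in eq
  ... | yes z = root-step k (s≤s⁻¹ (≤-trans (decreasing z) μ≤))
  ... | no  _ rewrite eq = refl

  -- The witness returned is the one found by `Z?`, possibly not the given one, and `σ` may depend
  -- on it; users have to identify the two.
  root-on : ∀ k {i} → μ i ≤ k → Z i → ∃ λ (z : Z i) → root k i ≡ root k (σ z)
  root-on k {i} μ≤ z with Z? i in eq | root-step k μ≤
  ... | yes z′ | eq′ = z′ , sym eq′
  ... | no ¬z  | _   = contradiction z ¬z

  root-≤ : (∀ {i} (z : Z i) → σ z ≤ i) → ∀ k i → root k i ≤ i
  root-≤ σ≤ zero    i = ≤-refl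
  root-≤ σ≤ (suc k) i = ≤-trans (root-≤ σ≤ k (step i)) step-≤
    where
    step-≤ : step i ≤ i
    step-≤ with Z? i
    ... | yes z = σ≤ z
    ... | no  _ = ≤-refl

-- The two halves of a comparison of counts: `Extends` finds a partner with the same letters off
-- `Z`, where `e i ≤ i` is the inversion sequence bound, and `Determines` makes the pairing
-- injective.
Determines : ℕ → ((ℕ → ℕ) → Set) → (ℕ → Set) → Set
Determines n P Z = ∀ {e e′} → P e → P e′ → (∀ {i} → i < n → ¬ Z i → e i ≡ e′ i) →
  ∀ {i} → i < n → e i ≡ e′ i

Extends : ℕ → (P P′ : (ℕ → ℕ) → Set) → (ℕ → Set) → Set
Extends n P P′ Z = ∀ {e} → P e → (∀ {i} → i < n → e i ≤ i) →
  ∃ λ e′ → P′ e′ × (∀ {i} → i < n → e′ i ≤ i) × (∀ {i} → ¬ Z i → e′ i ≡ e i)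

-- Rows, links and the conditions on them

module Rows {r s : ℕ} (0<r : 0 < r) (0<s : 0 < s) (T : ℕ → Set) where

  q : ℕ
  q = suc r

  -- Both are properties of the position alone: a row that is last in one occurrence can be linked
  -- through another.
  Row Link : ℕ → Set
  Row  ρ = ∃₂ λ t a → T t × a < s × ρ ≡ t + a * q
  Link ρ = ∃₂ λ t a → T t × suc a < s × ρ ≡ t + a * q

  next-row : ∀ t a → t + a * q + q ≡ t + suc a * q
  next-row t a = trans (+-assoc t (a * q) q) (cong (t +_) (+-comm (a * q) q))

  start-row : ∀ {t} → T t → Row t
  start-row {t} t∈ = t , 0 , t∈ , 0<s , sym (+-identityʳ t)

  link⇒row : ∀ {ρ} → Link ρ → Row ρ
  link⇒row (t , a , t∈ , a< , eq) = t , a , t∈ , <⇒≤ a< , eq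

  link⇒row-next : ∀ {ρ} → Link ρ → Row (ρ + q)
  link⇒row-next (t , a , t∈ , a< , refl) = t , suc a , t∈ , a< , next-row t a

  record RowConditions (e : ℕ → ℕ) : Set where
    field
      const : ∀ {ρ b} → Row ρ → b < r → e (ρ + suc b) ≡ e (ρ + 1)
      desc  : ∀ {ρ} → Row ρ → e (ρ + 1) < e ρ

  record Conditions₁ (e : ℕ → ℕ) : Set where
    field
      rows       : RowConditions e
      link-start : ∀ {ρ} → Link ρ → e (ρ + q) < e ρ
      link-rest  : ∀ {ρ} → Link ρ → e (ρ + q + 1) ≡ e (ρ + 1)
    open RowConditions rows public

  record Conditions₂ (e : ℕ → ℕ) : Set where
    field
      rows       : RowConditions e
      link-start : ∀ {ρ} → Link ρ → e (ρ + q) ≡ e ρ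
      link-rest  : ∀ {ρ} → Link ρ → e (ρ + q + 1) < e (ρ + 1)
    open RowConditions rows public

  record Conditions₃ (e : ℕ → ℕ) : Set where
    field
      rows       : RowConditions e
      link-start : ∀ {ρ} → Link ρ → e (ρ + q) ≡ e (ρ + 1)
    open RowConditions rows public

  -- Occurrences in terms of rows

  module _ {e : ℕ → ℕ} where

    private
      first : ∀ t a → e (t + a * q) ≡ e (t + a * q + 0)
      first t a = cong e (sym (+-identityʳ _))

      second : ∀ t a → e (t + a * q + q) ≡ e (t + suc a * q + 0)
      second t a = cong e (trans (next-row t a) (sym (+-identityʳ _)))

      second-rest : ∀ t a → e (t + a * q + q + 1) ≡ e (t + suc a * q + 1)
      second-rest t a = cong (λ i → e (i + 1)) (next-row t a)

    occurs⇒conditions₁ : (∀ {t} → T t → Shape.Occurs (shape₁ r s 0<r 0<s) e t) → Conditions₁ e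
    occurs⇒conditions₁ occ = record
      { rows = record
        { const = λ { (t , a , t∈ , a<s , refl) b<r → let open Shape.Occurs (occ t∈) in
            trans (values a<s b<r) (sym (values a<s 0<r)) }
        ; desc = λ { (t , a , t∈ , a<s , refl) → let open Shape.Occurs (occ t∈) in
            subst₂ _<_ (sym (values a<s 0<r)) (sym (trans (first t a) (values a<s z≤n)))
              (y-anti* a<s ≤-refl) } }
      ; link-start = λ { (t , a , t∈ , a<s , refl) → let open Shape.Occurs (occ t∈) in
          subst₂ _<_ (sym (trans (second t a) (values a<s z≤n)))
            (sym (trans (first t a) (values (<⇒≤ a<s) z≤n))) (y-anti (<⇒≤ a<s)) }
      ; link-rest = λ { (t , a , t∈ , a<s , refl) → let open Shape.Occurs (occ t∈) in
          trans (second-rest t a) (trans (values a<s 0<r) (sym (values (<⇒≤ a<s) 0<r))) }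
      }

    occurs⇒conditions₂ : (∀ {t} → T t → Shape.Occurs (shape₂ r s 0<r 0<s) e t) → Conditions₂ e
    occurs⇒conditions₂ occ = record
      { rows = record
        { const = λ { (t , a , t∈ , a<s , refl) b<r → let open Shape.Occurs (occ t∈) in
            trans (values a<s b<r) (sym (values a<s 0<r)) }
        ; desc = λ { (t , a , t∈ , a<s , refl) → let open Shape.Occurs (occ t∈) in
            subst₂ _<_ (sym (values a<s 0<r)) (sym (trans (first t a) (values a<s z≤n)))
              (y-anti* z<s a<s) } }
      ; link-start = λ { (t , a , t∈ , a<s , refl) → let open Shape.Occurs (occ t∈) in
          trans (second t a) (trans (values a<s z≤n)
            (sym (trans (first t a) (values (<⇒≤ a<s) z≤n)))) }
      ; link-rest = λ { (t , a , t∈ , a<s , refl) → let open Shape.Occurs (occ t∈) in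
          subst₂ _<_ (sym (trans (second-rest t a) (values a<s 0<r)))
            (sym (values (<⇒≤ a<s) 0<r)) (y-anti a<s) }
      }

    occurs⇒conditions₃ : (∀ {t} → T t → Shape.Occurs (shape₃ r s 0<r 0<s) e t) → Conditions₃ e
    occurs⇒conditions₃ occ = record
      { rows = record
        { const = λ { (t , a , t∈ , a<s , refl) b<r → let open Shape.Occurs (occ t∈) in
            trans (values a<s b<r) (sym (values a<s 0<r)) }
        ; desc = λ { (t , a , t∈ , a<s , refl) → let open Shape.Occurs (occ t∈) in
            subst₂ _<_ (sym (values a<s 0<r)) (sym (trans (first t a) (values a<s z≤n)))
              (y-anti a<s) } }
      ; link-start = λ { (t , a , t∈ , a<s , refl) → let open Shape.Occurs (occ t∈) in
          trans (second t a) (trans (values a<s z≤n) (sym (values (<⇒≤ a<s) 0<r))) }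
      }

    private
      module _ {t : ℕ} (t∈ : T t) where
        row : ∀ {a} → a < s → Row (t + a * q)
        row a<s = t , _ , t∈ , a<s , refl

        link : ∀ {a} → suc a < s → Link (t + a * q)
        link a<s = t , _ , t∈ , a<s , refl

    -- Chaining `link-rest` gives all rows of the occurrence the same repeated letter, which is the
    -- value of level `s`; the other levels take the row starts. The final descent is the one inside
    -- the last row.
    conditions₁⇒occurs : Conditions₁ e → ∀ {t} → T t → Shape.Occurs (shape₁ r s 0<r 0<s) e t
    conditions₁⇒occurs c {t} t∈ = record { y = y ; y-anti = anti ; values = values }
      where
      open Conditions₁ c
      open ≤-Reasoning
      rest : ∀ {a} → a < s → e (t + a * q + 1) ≡ e (t + 0 * q + 1)
      rest {zero}  _   = refl
      rest {suc a} a<s = begin-equality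
        e (t + suc a * q + 1)  ≡⟨ second-rest t a ⟨
        e (t + a * q + q + 1)  ≡⟨ link-rest (link t∈ a<s) ⟩
        e (t + a * q + 1)      ≡⟨ rest (<⇒≤ a<s) ⟩
        e (t + 0 * q + 1)      ∎
      y : ℕ → ℕ
      y k with k <? s
      ... | yes _ = e (t + k * q)
      ... | no  _ = e (t + 0 * q + 1)
      y-start : ∀ {k} → k < s → y k ≡ e (t + k * q)
      y-start {k} k<s with k <? s
      ... | yes _  = refl
      ... | no k≮s = contradiction k<s k≮s
      y-rest : y s ≡ e (t + 0 * q + 1)
      y-rest with s <? s
      ... | yes lt = contradiction lt (<-irrefl refl)
      ... | no _    = refl
      anti : ∀ {k} → k < s → y (suc k) < y k
      anti {k} k<s with m≤n⇒m<n∨m≡n k<s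
      ... | inj₁ k+1<s = begin-strict
        y (suc k)           ≡⟨ y-start k+1<s ⟩
        e (t + suc k * q)   ≡⟨ cong e (next-row t k) ⟨
        e (t + k * q + q)   <⟨ link-start (link t∈ k+1<s) ⟩
        e (t + k * q)       ≡⟨ y-start k<s ⟨
        y k                 ∎
      ... | inj₂ refl = begin-strict
        y (suc k)           ≡⟨ y-rest ⟩
        e (t + 0 * q + 1)   ≡⟨ rest k<s ⟨
        e (t + k * q + 1)   <⟨ desc (row t∈ k<s) ⟩
        e (t + k * q)       ≡⟨ y-start k<s ⟨
        y k                 ∎
      values : ∀ {a b} → a < s → b ≤ r → e (t + a * q + b) ≡ y (level₁ r s 0<r 0<s a b)
      values {a} {zero}  a<s _   = trans (sym (first t a)) (sym (y-start a<s))
      values {a} {suc b} a<s b<r =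
        trans (const (row t∈ a<s) b<r) (trans (rest a<s) (sym y-rest))

    -- Chaining `link-start` makes all row starts equal, giving level 0; the repeated letters give
    -- the others.
    conditions₂⇒occurs : Conditions₂ e → ∀ {t} → T t → Shape.Occurs (shape₂ r s 0<r 0<s) e t
    conditions₂⇒occurs c {t} t∈ = record { y = y ; y-anti = anti ; values = values }
      where
      open Conditions₂ c
      start : ∀ {a} → a < s → e (t + a * q) ≡ e (t + 0 * q)
      start {zero}  _   = refl
      start {suc a} a<s = trans (cong e (sym (next-row t a)))
        (trans (link-start (link t∈ a<s)) (start (<⇒≤ a<s)))
      y : ℕ → ℕ
      y zero    = e (t + 0 * q)
      y (suc a) = e (t + a * q + 1)
      anti : ∀ {k} → k < s → y (suc k) < y k
      anti {zero}  _   = desc (row t∈ 0<s)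
      anti {suc k} k<s = subst (_< e (t + k * q + 1)) (second-rest t k) (link-rest (link t∈ k<s))
      values : ∀ {a b} → a < s → b ≤ r → e (t + a * q + b) ≡ y (level₂ r s 0<r 0<s a b)
      values {a} {zero}  a<s _   = trans (sym (first t a)) (start a<s)
      values {a} {suc b} a<s b<r = const (row t∈ a<s) b<r

    -- Each row starts with the repeated letter of the row before, so the descents inside rows
    -- already order all the levels.
    conditions₃⇒occurs : Conditions₃ e → ∀ {t} → T t → Shape.Occurs (shape₃ r s 0<r 0<s) e t
    conditions₃⇒occurs c {t} t∈ = record { y = y ; y-anti = anti ; values = values }
      where
      open Conditions₃ c
      y : ℕ → ℕ
      y zero    = e (t + 0 * q)
      y (suc a) = e (t + a * q + 1)
      start : ∀ {a} → a < s → e (t + a * q) ≡ y a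
      start {zero}  _   = refl
      start {suc a} a<s = trans (cong e (sym (next-row t a))) (link-start (link t∈ a<s))
      anti : ∀ {k} → k < s → y (suc k) < y k
      anti k<s = subst (_ <_) (start k<s) (desc (row t∈ k<s))
      values : ∀ {a b} → a < s → b ≤ r → e (t + a * q + b) ≡ y (level₃ r s 0<r 0<s a b)
      values {a} {zero}  a<s _   = trans (sym (first t a)) (start a<s)
      values {a} {suc b} a<s b<r = const (row t∈ a<s) b<r

  -- Separation of occurrences

  -- The bound on `d` says that the two occurrences share at least two letters.
  Separated : Set
  Separated = ∀ {t} d → T t → T (t + d) → suc d < s * q → ∃ λ c → d ≡ c * q

  -- A descent inside the span of an occurrence is at the start of a row.
  separated : ∀ {e} → RowConditions e → (∀ {ρ} → Link ρ → e (ρ + 1) ≤ e (ρ + q)) → Separated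
  separated {e} c rise {t} d t∈ t′∈ d< with cell-of r s d (<⇒≤ d<)
  ... | a , zero  , _   , _         , refl = a , +-identityʳ _
  ... | a , suc b , a<s , s<s b<r , refl = contradiction fall (≤⇒≯ no-fall)
    where
    open RowConditions c
    open ≤-Reasoning
    ρ = t + a * q
    assoc : t + (a * q + suc b) ≡ ρ + suc b
    assoc = sym (+-assoc t (a * q) (suc b))
    fall : e (ρ + suc b + 1) < e (ρ + suc b)
    fall = subst (λ i → e (i + 1) < e i) assoc (desc (start-row t′∈))
    row : Row ρ
    row = t , a , t∈ , a<s , refl
    after : ρ + suc b + 1 ≡ ρ + suc (suc b)
    after = trans (+-comm _ 1) (sym (+-suc ρ (suc b)))
    no-fall : e (ρ + suc b) ≤ e (ρ + suc b + 1)
    -- The next letter belongs to the same row, or it opens the next row and `rise` applies.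
    no-fall with m≤n⇒m<n∨m≡n b<r
    ... | inj₁ b+1<r = begin
      e (ρ + suc b)        ≡⟨ const row b<r ⟩
      e (ρ + 1)            ≡⟨ const row b+1<r ⟨
      e (ρ + suc (suc b))  ≡⟨ cong e after ⟨
      e (ρ + suc b + 1)    ∎
    ... | inj₂ refl = begin
      e (ρ + suc b)        ≡⟨ const row b<r ⟩
      e (ρ + 1)            ≤⟨ rise (t , a , t∈ , a+1<s , refl) ⟩
      e (ρ + q)            ≡⟨ cong e after ⟨
      e (ρ + suc b + 1)    ∎
      where
      -- The last cell of the last row is ruled out by `d<`: starting there would mean sharing a
      -- single letter.
      a+1<s : suc a < s
      a+1<s = *-cancelʳ-< q (suc a) s (begin-strict
        suc a * q            ≡⟨ +-comm q (a * q) ⟩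
        a * q + q            ≡⟨ +-suc (a * q) r ⟩
        suc (a * q + suc b)  <⟨ d< ⟩
        s * q                ∎)

  module Disjoint (sep : Separated) where

    private
      reassoc : ∀ t d x y → t + d + x + y ≡ t + (d + (x + y))
      reassoc = solve-∀

      distrib : ∀ c a q b → c * q + (a * q + b) ≡ (c + a) * q + b
      distrib = solve-∀

      -- The later occurrence contains its first letter and the common cell, and the earlier one
      -- contains both, so `sep` applies; then residues modulo `q` give equal cells.
      aligned : ∀ {t a b} d {a′ b′} → T t → T (t + d) → a < s → b < r → b′ < r →
        t + a * q + suc b ≡ t + d + a′ * q + suc b′ → t + a * q ≡ t + d + a′ * q
      aligned {t} {a} {b} d {a′} {b′} t∈ t′∈ a<s b<r b′<r eq = +-cancelʳ-≡ (suc b) _ _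
        (trans eq (cong (t + d + a′ * q +_) (sym (b≡b′ (sep d t∈ t′∈ d<)))))
        where
        eq′ : a * q + suc b ≡ d + (a′ * q + suc b′)
        eq′ = +-cancelˡ-≡ t _ _ (trans (sym (+-assoc t _ _)) (trans eq (reassoc t d _ _)))
        d< : suc d < s * q
        d< = begin-strict
          suc d                       ≡⟨ +-comm 1 d ⟩
          d + 1                       ≤⟨ +-monoʳ-≤ d (≤-trans (s≤s z≤n) (m≤n+m (suc b′) (a′ * q))) ⟩
          d + (a′ * q + suc b′)       ≡⟨ eq′ ⟨
          a * q + suc b               <⟨ cell-bound a<s (s<s b<r) ⟩
          s * q                       ∎
          where open ≤-Reasoning
        b≡b′ : ∃ (λ c → d ≡ c * q) → suc b ≡ suc b′
        b≡b′ (c , refl) = cell-unique a (c + a′) (s<s b<r) (s<s b′<r)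
          (trans eq′ (distrib c a′ q (suc b′)))

    -- This makes it consistent to rewrite a repeated letter according to its row when occurrences
    -- overlap.
    row-of-cell : ∀ {ρ ρ′ b b′} → Row ρ → Row ρ′ → b < r → b′ < r →
      ρ + suc b ≡ ρ′ + suc b′ → ρ ≡ ρ′
    row-of-cell (t , a , t∈ , a<s , refl) (t′ , a′ , t′∈ , a′<s , refl) b<r b′<r eq
      with ≤-total t t′
    ... | inj₁ t≤t′ with d , refl ← m≤n⇒∃[o]m+o≡n t≤t′ =
      aligned {a = a} d {a′} t∈ t′∈ a<s b<r b′<r eq
    ... | inj₂ t′≤t with d , refl ← m≤n⇒∃[o]m+o≡n t′≤t =
      sym (aligned {a = a′} d {a} t′∈ t∈ a′<s b′<r b<r (sym eq))

    private
      -- The disjunction excludes a last row against a first row, where the last letter of one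
      -- occurrence may open another. Otherwise a coincidence would mean an overlap of two letters,
      -- and residues modulo `q` contradict it.
      cell≢start : ∀ {t a b t′ a′} → T t → T t′ → a < s → a′ < s → b < r →
        suc a < s ⊎ 0 < a′ → t + a * q + suc b ≢ t′ + a′ * q
      cell≢start {t} {a} {b} {t′} {a′} t∈ t′∈ a<s a′<s b<r cond eq with ≤-total t t′
      ... | inj₁ t≤t′ with d , refl ← m≤n⇒∃[o]m+o≡n t≤t′ = impossible (sep d t∈ t′∈ (d< cond))
        where
        open ≤-Reasoning
        eq′ : a * q + suc b ≡ d + a′ * q
        eq′ = +-cancelˡ-≡ t _ _ (trans (sym (+-assoc t _ _)) (trans eq (+-assoc t d _)))
        d< : suc a < s ⊎ 0 < a′ → suc d < s * q
        d< (inj₁ a+1<s) = begin-strict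
          suc d                  ≤⟨ s≤s (m≤m+n d (a′ * q)) ⟩
          suc (d + a′ * q)       ≡⟨ cong suc eq′ ⟨
          suc (a * q + suc b)    ≡⟨ +-suc (a * q) (suc b) ⟨
          a * q + suc (suc b)    ≤⟨ +-monoʳ-≤ (a * q) (s≤s b<r) ⟩
          a * q + q              ≡⟨ +-comm (a * q) q ⟩
          suc a * q              <⟨ *-monoˡ-< q a+1<s ⟩
          s * q                  ∎
        d< (inj₂ 0<a′) = begin-strict
          suc d                  ≡⟨ +-comm 1 d ⟩
          d + 1                  ≤⟨ +-monoʳ-≤ d (*-mono-≤ 0<a′ (s≤s (z≤n {r}))) ⟩
          d + a′ * q             ≡⟨ eq′ ⟨
          a * q + suc b          <⟨ cell-bound a<s (s<s b<r) ⟩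
          s * q                  ∎
        impossible : ¬ ∃ (λ c → d ≡ c * q)
        impossible (c , refl) = 1+n≢0 (cell-unique a (c + a′) (s<s b<r) z<s
          (trans eq′ (trans (cong (c * q +_) (sym (+-identityʳ _))) (distrib c a′ q 0))))
      ... | inj₂ t′≤t with d , refl ← m≤n⇒∃[o]m+o≡n t′≤t = impossible (sep d t′∈ t∈ d<)
        where
        open ≤-Reasoning
        eq′ : d + (a * q + suc b) ≡ a′ * q
        eq′ = +-cancelˡ-≡ t′ _ _ (trans (sym (reassoc t′ d _ _)) eq)
        d< : suc d < s * q
        d< = begin-strict
          suc d                  ≡⟨ +-comm 1 d ⟩
          d + 1                  ≤⟨ +-monoʳ-≤ d (≤-trans (s≤s z≤n) (m≤n+m (suc b) (a * q))) ⟩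
          d + (a * q + suc b)    ≡⟨ eq′ ⟩
          a′ * q                 <⟨ *-monoˡ-< q a′<s ⟩
          s * q                  ∎
        impossible : ¬ ∃ (λ c → d ≡ c * q)
        impossible (c , refl) = 1+n≢0 (cell-unique (c + a) a′ (s<s b<r) z<s
          (trans (sym (distrib c a q (suc b))) (trans eq′ (sym (+-identityʳ _)))))

    linked-cell≢row : ∀ {ρ ρ′ b} → Link ρ → Row ρ′ → b < r → ρ + suc b ≢ ρ′
    linked-cell≢row (t , a , t∈ , a<s , refl) (t′ , a′ , t′∈ , a′<s , refl) b<r =
      cell≢start t∈ t′∈ (<⇒≤ a<s) a′<s b<r (inj₁ a<s)

    cell≢linked-row : ∀ {ρ ρ′ b} → Link ρ → Row ρ′ → b < r → ρ′ + suc b ≢ ρ + q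
    cell≢linked-row (t , a , t∈ , a<s , refl) (t′ , a′ , t′∈ , a′<s , refl) b<r eq =
      cell≢start t′∈ t∈ a′<s a<s b<r (inj₂ z<s) (trans eq (next-row t a))

  -- Exchanging the shapes

  -- The hypothesis of `separated`. With rows `x m^r` and `x′ m′^r`, here `m = m′ < x′`; for `Q₂` it
  -- is `m < x = x′`, and for `Q₃` `m = x′`.
  rise₁ : ∀ {e} → Conditions₁ e → ∀ {ρ} → Link ρ → e (ρ + 1) ≤ e (ρ + q)
  rise₁ {e} c {ρ} l = subst (_≤ e (ρ + q)) (link-rest l) (<⇒≤ (desc (link⇒row-next l)))
    where open Conditions₁ c

  rise₂ : ∀ {e} → Conditions₂ e → ∀ {ρ} → Link ρ → e (ρ + 1) ≤ e (ρ + q)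
  rise₂ {e} c {ρ} l = subst (e (ρ + 1) ≤_) (sym (link-start l)) (<⇒≤ (desc (link⇒row l)))
    where open Conditions₂ c

  rise₃ : ∀ {e} → Conditions₃ e → ∀ {ρ} → Link ρ → e (ρ + 1) ≤ e (ρ + q)
  rise₃ c l = ≤-reflexive (sym (link-start l))
    where open Conditions₃ c

  -- The two sets of letters to be forgotten and refilled: the `x′` and the `m` of linked rows.
  LinkedRow LinkedCell : ℕ → Set
  LinkedRow  i = ∃ λ ρ → Link ρ × i ≡ ρ + q
  LinkedCell i = ∃₂ λ ρ b → Link ρ × b < r × i ≡ ρ + suc b

  module Exchange (T? : ∀ t → Dec (T t)) (n : ℕ) (bounded : ∀ {t} → T t → t + s * q ≤ n) where

    row-bound : ∀ {ρ b} → Row ρ → b ≤ r → ρ + b < n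
    row-bound {b = b} (t , a , t∈ , a<s , refl) b≤r = begin-strict
      t + a * q + b    ≡⟨ +-assoc t (a * q) b ⟩
      t + (a * q + b)  <⟨ +-monoʳ-< t (cell-bound a<s (s≤s b≤r)) ⟩
      t + s * q        ≤⟨ bounded t∈ ⟩
      n                ∎
      where open ≤-Reasoning

    next-bound : ∀ {ρ} → Link ρ → ρ + q < n
    next-bound l = subst (_< n) (+-identityʳ _) (row-bound (link⇒row-next l) z≤n)

    Link? : ∀ ρ → Dec (Link ρ)
    Link? ρ = map′
      (λ { (t , _ , t∈ , a , _ , a< , eq) → t , a , t∈ , a< , eq })
      (λ { (t , a , t∈ , a< , eq) → t , s≤s (≤-trans (m≤m+n t _) (≤-reflexive (sym eq))) ,
          t∈ , a , <⇒≤ a< , a< , eq })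
      (anyUpTo? (λ t → T? t ×-dec anyUpTo? (λ a → (suc a <? s) ×-dec (ρ ≟ t + a * q)) s) (suc ρ))

    LinkedRow? : ∀ i → Dec (LinkedRow i)
    LinkedRow? i = map′
      (λ { (ρ , _ , l , eq) → ρ , l , eq })
      (λ { (ρ , l , eq) → ρ , s≤s (≤-trans (m≤m+n ρ q) (≤-reflexive (sym eq))) , l , eq })
      (anyUpTo? (λ ρ → Link? ρ ×-dec (i ≟ ρ + q)) (suc i))

    LinkedCell? : ∀ i → Dec (LinkedCell i)
    LinkedCell? i = map′
      (λ { (ρ , _ , l , b , b<r , eq) → ρ , b , l , b<r , eq })
      (λ { (ρ , b , l , b<r , eq) → ρ , s≤s (≤-trans (m≤m+n ρ (suc b)) (≤-reflexive (sym eq))) ,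
          l , b , b<r , eq })
      (anyUpTo? (λ ρ → Link? ρ ×-dec anyUpTo? (λ b → i ≟ ρ + suc b) r) (suc i))

    -- Following equal letters along decreasing `μ` ends off `Z`, where the two sequences agree. The
    -- measure is `id` for moves to the left and `n ∸_` for moves to the right.
    determines : ∀ {P Z} → (∀ i → Dec (Z i)) → (μ : ℕ → ℕ) →
      (∀ {i} → Z i → ∃ λ j → j < n × μ j < μ i × (∀ {e} → P e → e i ≡ e j)) → Determines n P Z
    determines {Z = Z} Z? μ move {e} {e′} p p′ off {i} = go i (<-wellFounded (μ i))
      where
      go : ∀ i → Acc _<_ (μ i) → i < n → e i ≡ e′ i
      go i (acc rec) i<n with Z? i
      ... | no ¬z = off i<n ¬z
      ... | yes z with j , j<n , μ< , same ← move z =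
        trans (same p) (trans (go j (rec μ<) j<n) (sym (same p′)))

    ρ+1<ρ+q : ∀ ρ → ρ + 1 < ρ + q
    ρ+1<ρ+q ρ = +-monoʳ-< ρ (s<s 0<r)

    cell<next : ∀ ρ {b} → b < r → ρ + suc b < ρ + q
    cell<next ρ b<r = +-monoʳ-< ρ (s<s b<r)

    determined₂ : Determines n Conditions₂ LinkedRow
    determined₂ = determines LinkedRow? id λ { (ρ , l , refl) →
      ρ , ≤-<-trans (m≤m+n ρ 0) (row-bound (link⇒row l) z≤n) , m<m+n ρ z<s ,
      λ c → Conditions₂.link-start c l }

    determined₃-row : Determines n Conditions₃ LinkedRow
    determined₃-row = determines LinkedRow? id λ { (ρ , l , refl) →
      ρ + 1 , row-bound (link⇒row l) 0<r , ρ+1<ρ+q ρ , λ c → Conditions₃.link-start c l }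

    determined₃-cell : Determines n Conditions₃ LinkedCell
    determined₃-cell = determines LinkedCell? (n ∸_) λ { (ρ , b , l , b<r , refl) →
      ρ + q , next-bound l , ∸-monoʳ-< (cell<next ρ b<r) (<⇒≤ (next-bound l)) ,
      λ c → let open Conditions₃ c in trans (const (link⇒row l) b<r) (sym (link-start l)) }

    determined₁ : Determines n Conditions₁ LinkedCell
    determined₁ = determines LinkedCell? (n ∸_) λ { (ρ , b , l , b<r , refl) →
      let next< = row-bound (link⇒row-next l) b<r in
      ρ + q + suc b , next< , ∸-monoʳ-< (+-monoˡ-< (suc b) (m<m+n ρ z<s)) (<⇒≤ next<) ,
      λ c → let open Conditions₁ c in trans (const (link⇒row l) b<r)
        (trans (sym (link-rest l)) (sym (const (link⇒row-next l) b<r))) }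

    -- Each `x′` becomes `m`, and `m > m′` keeps the descent of the next row. Values are copied from
    -- earlier positions, which preserves the bound.
    extend₂₃ : Extends n Conditions₂ Conditions₃ LinkedRow
    extend₂₃ {e} c e≤ = f , conditions , f≤ , λ ¬z → cong e (root-off n ¬z)
      where
      open Conditions₂ c
      open Disjoint (separated rows (rise₂ c))
      σ : ∀ {i} → LinkedRow i → ℕ
      σ (ρ , _) = ρ + 1
      σ< : ∀ {i} (z : LinkedRow i) → σ z < i
      σ< (ρ , _ , refl) = ρ+1<ρ+q ρ
      open Fill LinkedRow? σ id σ<
      f : ℕ → ℕ
      f i = e (root n i)
      f≤ : ∀ {i} → i < n → f i ≤ i
      f≤ {i} i<n = ≤-trans (e≤ (≤-<-trans root≤i i<n)) root≤i
        where root≤i = root-≤ (λ z → <⇒≤ (σ< z)) n i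
      cell : ∀ {ρ b} → Row ρ → b < r → f (ρ + suc b) ≡ e (ρ + suc b)
      cell row b<r = cong e (root-off n λ { (ρ′ , l , eq) → cell≢linked-row l row b<r eq })
      on : ∀ {ρ} → Link ρ → f (ρ + q) ≡ e (ρ + 1)
      on {ρ} l with root-on n (<⇒≤ (next-bound l)) (ρ , l , refl)
      -- The row found by the decision procedure is the given one, as both have the same successor.
      ... | (ρ′ , l′ , eq) , same rewrite +-cancelʳ-≡ q ρ ρ′ eq =
        trans (cong e same) (cell (link⇒row l′) 0<r)
      desc′ : ∀ {ρ} → Row ρ → f (ρ + 1) < f ρ
      desc′ {ρ} row with LinkedRow? ρ
      ... | yes (ρ′ , l , refl) = subst₂ _<_ (sym (cell row 0<r)) (sym (on l)) (link-rest l)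
      ... | no ¬z = subst₂ _<_ (sym (cell row 0<r)) (sym (cong e (root-off n ¬z))) (desc row)
      conditions : Conditions₃ f
      conditions = record
        { rows = record
          { const = λ row b<r → trans (cell row b<r) (trans (const row b<r) (sym (cell row 0<r)))
          ; desc  = desc′ }
        ; link-start = λ l → trans (on l) (sym (cell (link⇒row l) 0<r))
        }

    -- Each `x′` becomes the new value of `x`, back to the first row of the chain of links. Row
    -- starts can only grow, so descents survive, and `m > m′` follows from `m = x′ > m′` in `e`.
    extend₃₂ : Extends n Conditions₃ Conditions₂ LinkedRow
    extend₃₂ {e} c e≤ = f , conditions , f≤ , λ ¬z → cong e (root-off n ¬z)
      where
      open Conditions₃ c
      open Disjoint (separated rows (rise₃ c))
      σ< : ∀ {i} (z : LinkedRow i) → proj₁ z < i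
      σ< (ρ , _ , refl) = m<m+n ρ z<s
      open Fill LinkedRow? proj₁ id σ<
      open ≤-Reasoning
      f : ℕ → ℕ
      f i = e (root n i)
      f≤ : ∀ {i} → i < n → f i ≤ i
      f≤ {i} i<n = ≤-trans (e≤ (≤-<-trans root≤i i<n)) root≤i
        where root≤i = root-≤ (λ z → <⇒≤ (σ< z)) n i
      cell : ∀ {ρ b} → Row ρ → b < r → f (ρ + suc b) ≡ e (ρ + suc b)
      cell row b<r = cong e (root-off n λ { (ρ′ , l , eq) → cell≢linked-row l row b<r eq })
      on : ∀ {ρ} → Link ρ → f (ρ + q) ≡ f ρ
      on {ρ} l with root-on n (<⇒≤ (next-bound l)) (ρ , l , refl)
      ... | (ρ′ , l′ , eq) , same rewrite +-cancelʳ-≡ q ρ ρ′ eq = cong e same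
      above : ∀ i → Acc _<_ i → e i ≤ f i
      above i (acc rec) with LinkedRow? i
      ... | no ¬z = ≤-reflexive (cong e (sym (root-off n ¬z)))
      ... | yes (ρ , l , refl) = begin
        e (ρ + q)  ≡⟨ link-start l ⟩
        e (ρ + 1)  ≤⟨ <⇒≤ (desc (link⇒row l)) ⟩
        e ρ        ≤⟨ above ρ (rec (m<m+n ρ z<s)) ⟩
        f ρ        ≡⟨ on l ⟨
        f (ρ + q)  ∎
      conditions : Conditions₂ f
      conditions = record
        { rows = record
          { const = λ row b<r → trans (cell row b<r) (trans (const row b<r) (sym (cell row 0<r)))
          ; desc  = λ {ρ} row → subst (_< f ρ) (sym (cell row 0<r))
              (<-≤-trans (desc row) (above ρ (<-wellFounded ρ))) }
        ; link-start = on
        ; link-rest = λ {ρ} l → begin-strict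
            f (ρ + q + 1)  ≡⟨ cell (link⇒row-next l) 0<r ⟩
            e (ρ + q + 1)  <⟨ desc (link⇒row-next l) ⟩
            e (ρ + q)      ≡⟨ link-start l ⟩
            e (ρ + 1)      ≡⟨ cell (link⇒row l) 0<r ⟨
            f (ρ + 1)      ∎
        }

    -- The `m` of a linked row becomes `x′`, and `x > x′` is the new descent. Row starts are
    -- unchanged, because no row starts at a linked cell.
    extend₁₃ : Extends n Conditions₁ Conditions₃ LinkedCell
    extend₁₃ {e} c e≤ = f , conditions , f≤ , λ ¬z → cong e (root-off n ¬z)
      where
      open Conditions₁ c
      open Disjoint (separated rows (rise₁ c))
      σ : ∀ {i} → LinkedCell i → ℕ
      σ (ρ , _) = ρ + q
      σ-right : ∀ {i} (z : LinkedCell i) → n ∸ σ z < n ∸ i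
      σ-right (ρ , b , l , b<r , refl) = ∸-monoʳ-< (cell<next ρ b<r) (<⇒≤ (next-bound l))
      open Fill LinkedCell? σ (n ∸_) σ-right
      open ≤-Reasoning
      f : ℕ → ℕ
      f i = e (root n i)
      row-start : ∀ {ρ} → Row ρ → f ρ ≡ e ρ
      row-start row = cong e (root-off n λ { (ρ′ , b , l , b<r , eq) →
        linked-cell≢row l row b<r (sym eq) })
      linked : ∀ {ρ b} → Link ρ → b < r → f (ρ + suc b) ≡ e (ρ + q)
      linked {ρ} {b} l b<r with root-on n (m∸n≤m n (ρ + suc b)) (ρ , b , l , b<r , refl)
      ... | (ρ′ , b′ , l′ , b′<r , eq) , same
        rewrite row-of-cell (link⇒row l) (link⇒row l′) b<r b′<r eq =
        trans (cong e same) (row-start (link⇒row-next l′))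
      unlinked : ∀ {ρ b} → Row ρ → ¬ Link ρ → b < r → f (ρ + suc b) ≡ e (ρ + suc b)
      unlinked row ¬l b<r = cong e (root-off n λ { (ρ′ , b′ , l , b′<r , eq) →
        ¬l (subst Link (sym (row-of-cell row (link⇒row l) b<r b′<r eq)) l) })
      f≤ : ∀ {i} → i < n → f i ≤ i
      f≤ {i} i<n with LinkedCell? i
      ... | no ¬z = subst (_≤ i) (sym (cong e (root-off n ¬z))) (e≤ i<n)
      -- The value comes from the right, where the bound is too weak; it is however below the letter
      -- opening its own row.
      ... | yes (ρ , b , l , b<r , refl) = begin
        f (ρ + suc b)  ≡⟨ linked l b<r ⟩
        e (ρ + q)      ≤⟨ <⇒≤ (link-start l) ⟩
        e ρ            ≤⟨ e≤ (≤-<-trans (m≤m+n ρ _) i<n) ⟩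
        ρ              ≤⟨ m≤m+n ρ _ ⟩
        ρ + suc b      ∎
      rows′ : RowConditions f
      rows′ = record { const = const′ ; desc = desc′ }
        where
        const′ : ∀ {ρ b} → Row ρ → b < r → f (ρ + suc b) ≡ f (ρ + 1)
        const′ {ρ} row b<r with Link? ρ
        ... | yes l = trans (linked l b<r) (sym (linked l 0<r))
        ... | no ¬l = trans (unlinked row ¬l b<r) (trans (const row b<r) (sym (unlinked row ¬l 0<r)))
        desc′ : ∀ {ρ} → Row ρ → f (ρ + 1) < f ρ
        desc′ {ρ} row with Link? ρ
        ... | yes l = subst₂ _<_ (sym (linked l 0<r)) (sym (row-start row)) (link-start l)
        ... | no ¬l = subst₂ _<_ (sym (unlinked row ¬l 0<r)) (sym (row-start row)) (desc row)
      conditions : Conditions₃ f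
      conditions = record
        { rows = rows′
        ; link-start = λ l → trans (row-start (link⇒row-next l)) (sym (linked l 0<r))
        }

    -- The `m` of a linked row becomes the repeated letter at the end of its chain of links. Letters
    -- can only drop, which keeps both the bound and the descents; `x > x′` follows from
    -- `x > m = x′` in `e`.
    extend₃₁ : Extends n Conditions₃ Conditions₁ LinkedCell
    extend₃₁ {e} c e≤ = f , conditions ,
      (λ {i} i<n → ≤-trans (below i (<-wellFounded _)) (e≤ i<n)) , λ ¬z → cong e (root-off n ¬z)
      where
      open Conditions₃ c
      open Disjoint (separated rows (rise₃ c))
      right : ∀ {ρ b} → Link ρ → b < r → n ∸ (ρ + q + suc b) < n ∸ (ρ + suc b)
      right {ρ} {b} l b<r = ∸-monoʳ-< (+-monoˡ-< (suc b) (m<m+n ρ z<s))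
        (<⇒≤ (row-bound (link⇒row-next l) b<r))
      σ : ∀ {i} → LinkedCell i → ℕ
      σ (ρ , b , _) = ρ + q + suc b
      σ-right : ∀ {i} (z : LinkedCell i) → n ∸ σ z < n ∸ i
      σ-right (ρ , b , l , b<r , refl) = right l b<r
      open Fill LinkedCell? σ (n ∸_) σ-right
      open ≤-Reasoning
      f : ℕ → ℕ
      f i = e (root n i)
      row-start : ∀ {ρ} → Row ρ → f ρ ≡ e ρ
      row-start row = cong e (root-off n λ { (ρ′ , b , l , b<r , eq) →
        linked-cell≢row l row b<r (sym eq) })
      linked : ∀ {ρ b} → Link ρ → b < r → f (ρ + suc b) ≡ f (ρ + q + suc b)
      linked {ρ} {b} l b<r with root-on n (m∸n≤m n (ρ + suc b)) (ρ , b , l , b<r , refl)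
      -- The witness found has the same row by `row-of-cell`, hence the same cell.
      ... | (ρ′ , b′ , l′ , b′<r , eq) , same
        with refl ← row-of-cell (link⇒row l) (link⇒row l′) b<r b′<r eq
        with refl ← +-cancelˡ-≡ ρ (suc b) (suc b′) eq = cong e same
      unlinked : ∀ {ρ b} → Row ρ → ¬ Link ρ → b < r → f (ρ + suc b) ≡ e (ρ + suc b)
      unlinked row ¬l b<r = cong e (root-off n λ { (ρ′ , b′ , l , b′<r , eq) →
        ¬l (subst Link (sym (row-of-cell row (link⇒row l) b<r b′<r eq)) l) })
      below : ∀ i → Acc _<_ (n ∸ i) → f i ≤ e i
      below i (acc rec) with LinkedCell? i
      ... | no ¬z = ≤-reflexive (cong e (root-off n ¬z))
      ... | yes (ρ , b , l , b<r , refl) = begin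
        f (ρ + suc b)      ≡⟨ linked l b<r ⟩
        f (ρ + q + suc b)  ≤⟨ below (ρ + q + suc b) (rec (right l b<r)) ⟩
        e (ρ + q + suc b)  ≡⟨ const (link⇒row-next l) b<r ⟩
        e (ρ + q + 1)      ≤⟨ <⇒≤ (desc (link⇒row-next l)) ⟩
        e (ρ + q)          ≡⟨ link-start l ⟩
        e (ρ + 1)          ≡⟨ const (link⇒row l) b<r ⟨
        e (ρ + suc b)      ∎
      -- Cells are copied one by one along the chain, so constancy is carried back from its unlinked
      -- end, where `f` agrees with `e`.
      const′ : ∀ {ρ b} → Acc _<_ (n ∸ ρ) → Row ρ → b < r → f (ρ + suc b) ≡ f (ρ + 1)
      const′ {ρ} {b} (acc rec) row b<r with Link? ρ
      ... | no ¬l = trans (unlinked row ¬l b<r) (trans (const row b<r) (sym (unlinked row ¬l 0<r)))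
      ... | yes l = begin-equality
        f (ρ + suc b)      ≡⟨ linked l b<r ⟩
        f (ρ + q + suc b)
          ≡⟨ const′ (rec (∸-monoʳ-< (m<m+n ρ z<s) (<⇒≤ (next-bound l)))) (link⇒row-next l) b<r ⟩
        f (ρ + q + 1)      ≡⟨ linked l 0<r ⟨
        f (ρ + 1)          ∎
      conditions : Conditions₁ f
      conditions = record
        { rows = record
          { const = const′ (<-wellFounded _)
          ; desc  = λ {ρ} row → begin-strict
              f (ρ + 1)  ≤⟨ below (ρ + 1) (<-wellFounded _) ⟩
              e (ρ + 1)  <⟨ desc row ⟩
              e ρ        ≡⟨ row-start row ⟨
              f ρ        ∎ }
        ; link-start = λ {ρ} l → begin-strict
            f (ρ + q)  ≡⟨ row-start (link⇒row-next l) ⟩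
            e (ρ + q)  ≡⟨ link-start l ⟩
            e (ρ + 1)  <⟨ desc (link⇒row l) ⟩
            e ρ        ≡⟨ row-start (link⇒row l) ⟨
            f ρ        ∎
        ; link-rest = λ l → sym (linked l 0<r)
        }

-- Counting inversion sequences

letterAt : ∀ {n} → Vec ℕ n → ℕ → ℕ
letterAt e = nth (toList e)

letterAt-lookup : ∀ {n} (e : Vec ℕ n) k → letterAt e (toℕ k) ≡ lookup e k
letterAt-lookup (x ∷ e) Fin.zero    = refl
letterAt-lookup (x ∷ e) (Fin.suc k) = letterAt-lookup e k

letterAt-tabulate : ∀ {n} (f : ℕ → ℕ) {i} → i < n →
  letterAt (tabulate {n = n} (λ k → f (toℕ k))) i ≡ f i
letterAt-tabulate {suc n} f {zero}  _        = refl
letterAt-tabulate {suc n} f {suc i} (s<s i<) = letterAt-tabulate (λ j → f (suc j)) i<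

letterAt-injective : ∀ {n} {e e′ : Vec ℕ n} → (∀ {i} → i < n → letterAt e i ≡ letterAt e′ i) →
  e ≡ e′
letterAt-injective {e = []}    {[]}     _ = refl
letterAt-injective {e = x ∷ e} {y ∷ e′} h =
  cong₂ _∷_ (h z<s) (letterAt-injective {e′ = e′} (λ i< → h (s<s i<)))

𝐈-letters : ∀ {n} {e : Vec ℕ n} → e ∈ 𝐈 n → ∀ {i} → i < n → letterAt e i ≤ i
𝐈-letters {e = e} e∈ {i} i<n = begin
  letterAt e i                    ≡⟨ cong (letterAt e) (toℕ-fromℕ< i<n) ⟨
  letterAt e (toℕ (fromℕ< i<n))   ≡⟨ letterAt-lookup e (fromℕ< i<n) ⟩
  lookup e (fromℕ< i<n)           ≤⟨ s≤s⁻¹ (Equivalence.to ∈-𝐈⇔ e∈ (fromℕ< i<n)) ⟩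
  toℕ (fromℕ< i<n)                ≡⟨ toℕ-fromℕ< i<n ⟩
  i                               ∎
  where open ≤-Reasoning

tabulate-∈-𝐈 : ∀ {n} {f : ℕ → ℕ} → (∀ {i} → i < n → f i ≤ i) → tabulate (λ k → f (toℕ k)) ∈ 𝐈 n
tabulate-∈-𝐈 f≤ = Equivalence.from ∈-𝐈⇔ λ k →
  s≤s (subst (_≤ toℕ k) (sym (lookup∘tabulate _ k)) (f≤ (toℕ<n k)))

∈-Em⁺ : ∀ {n} p (e : Vec ℕ n) k → reduction (take (length p) (drop (toℕ k) (toList e))) ≡ p →
  k ∈ˢ Em p e
∈-Em⁺ p e k eq = lookup⇒[]= k _ (trans (lookup∘tabulate _ k) (dec-true (≡-dec _≟_ _ p) eq))

∈-Em⁻ : ∀ {n} p (e : Vec ℕ n) k → k ∈ˢ Em p e →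
  reduction (take (length p) (drop (toℕ k) (toList e))) ≡ p
∈-Em⁻ p e k k∈ = witness (≡-dec _≟_ _ p) (trans (sym (lookup∘tabulate _ k)) ([]=⇒lookup k∈))
  where
  witness : ∀ {A : Set} (A? : Dec A) → does A? ≡ true → A
  witness (yes a) _ = a

Position : ∀ {n} → Subset n → ℕ → Set
Position T t = ∃ λ k → toℕ k ≡ t × k ∈ˢ T

position? : ∀ {n} (T : Subset n) t → Dec (Position T t)
position? T t = any? λ k → (toℕ k ≟ t) ×-dec (k ∈ˢ? T)

module _ {r s : ℕ} (0<s : 0 < s) {n : ℕ} (T : Subset n) where

  Fits : Set
  Fits = ∀ {t} → Position T t → t + s * suc r ≤ n

  OccursAt : Shape r s → (ℕ → ℕ) → Set
  OccursAt S f = ∀ {t} → Position T t → Shape.Occurs S f t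

  module _ (S : Shape r s) where
    open Shape S

    ⊆-Em⁻ : ∀ {p e} → Spelt p → T ⊆ Em p e → Fits × OccursAt S (letterAt e)
    ⊆-Em⁻ {p} {e} spelt T⊆ = (λ pos → proj₁ (at pos)) , (λ pos → proj₂ (at pos))
      where
      at : ∀ {t} → Position T t → t + s * suc r ≤ n × Occurs (letterAt e) t
      at (k , refl , k∈T)
        with fits , occ ← reduction⇒occurs spelt 0<s (toList e) (toℕ k) (∈-Em⁻ p e k (T⊆ k∈T)) =
        subst (_ ≤_) (length-toList e) fits , occ

    ⊆-Em⁺ : ∀ {p e} → Spelt p → Fits → OccursAt S (letterAt e) → T ⊆ Em p e
    ⊆-Em⁺ {p} {e} spelt fits occ {k} k∈T = ∈-Em⁺ p e k
      (occurs⇒reduction spelt 0<s (toList e) (toℕ k)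
        (subst (_ ≤_) (sym (length-toList e)) (fits pos)) (occ pos))
      where pos = k , refl , k∈T

    -- A vector tabulated from `f` agrees with `f` only below `n`; `Fits` keeps all occurrences in
    -- that range.
    occurs-cong : ∀ {f g} → Fits → (∀ {i} → i < n → f i ≡ g i) → OccursAt S f → OccursAt S g
    occurs-cong {f} {g} fits f≗g occ {t} pos = record
      { y = y ; y-anti = y-anti
      ; values = λ {a} {b} a<s b≤r → trans (sym (f≗g (begin-strict
          t + a * suc r + b    ≡⟨ +-assoc t (a * suc r) b ⟩
          t + (a * suc r + b)  <⟨ +-monoʳ-< t (cell-bound a<s (s≤s b≤r)) ⟩
          t + s * suc r        ≤⟨ fits pos ⟩
          n                    ∎))) (values a<s b≤r) }
      where
      open Occurs (occ pos)
      open ≤-Reasoning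

  -- Sequences are paired when they agree off `Z`. `Fits` may be assumed in the last two hypotheses,
  -- because any `e` with `T ⊆ Em p e` provides it.
  #⊇-≤ : ∀ {S S′ p p′} {P P′ : (ℕ → ℕ) → Set} (Z : ℕ → Set) →
    Shape.Spelt S p → Shape.Spelt S′ p′ →
    (∀ {f} → OccursAt S f → P f) → (∀ {f} → P′ f → OccursAt S′ f) →
    (Fits → Extends n P P′ Z) → (Fits → Determines n P Z) →
    #⊇ T (map (Em p) (𝐈 n)) ≤ #⊇ T (map (Em p′) (𝐈 n))
  #⊇-≤ {S} {S′} {p} {p′} Z spelt spelt′ toP fromP′ extends determined = begin
    #⊇ T (map (Em p) (𝐈 n))          ≡⟨ length-filter-map (T ⊆?_) (Em p) (𝐈 n) ⟩
    length (filter (P? p) (𝐈 n))     ≤⟨ injective-length {R = R} (λ {x} {x′} {y} → injective {x} {x′} {y})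
                                          (Unique.filter⁺ (P? p) (𝐈-unique n)) total ⟩
    length (filter (P? p′) (𝐈 n))    ≡⟨ length-filter-map (T ⊆?_) (Em p′) (𝐈 n) ⟨
    #⊇ T (map (Em p′) (𝐈 n))         ∎
    where
    open ≤-Reasoning
    P? : ∀ p e → Dec (T ⊆ Em p e)
    P? p e = T ⊆? Em p e
    R : Vec ℕ n → Vec ℕ n → Set
    R e e′ = T ⊆ Em p e × (∀ {i} → i < n → ¬ Z i → letterAt e i ≡ letterAt e′ i)
    injective : ∀ {e₁ e₂ e′} → R e₁ e′ → R e₂ e′ → e₁ ≡ e₂
    injective {e₂ = e₂} (T⊆₁ , same₁) (T⊆₂ , same₂)
      with fits , occ₁ ← ⊆-Em⁻ S spelt T⊆₁ | _ , occ₂ ← ⊆-Em⁻ S spelt T⊆₂ =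
      letterAt-injective {e′ = e₂} (determined fits (toP occ₁) (toP occ₂)
        (λ i<n ¬z → trans (same₁ i<n ¬z) (sym (same₂ i<n ¬z))))
    total : ∀ {e} → e ∈ filter (P? p) (𝐈 n) → ∃ λ e′ → e′ ∈ filter (P? p′) (𝐈 n) × R e e′
    total e∈ with e∈𝐈 , T⊆ ← ∈-filter⁻ (P? p) {xs = 𝐈 n} e∈
      with fits , occ ← ⊆-Em⁻ S spelt T⊆
      with f , p′f , f≤ , same ← extends fits (toP occ) (𝐈-letters e∈𝐈) =
      tabulate (λ k → f (toℕ k)) ,
      ∈-filter⁺ (P? p′) (tabulate-∈-𝐈 f≤) (⊆-Em⁺ S′ spelt′ fits
        (occurs-cong S′ fits (λ i<n → sym (letterAt-tabulate f i<n)) (fromP′ p′f))) ,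
      T⊆ , λ i<n ¬z → trans (sym (same ¬z)) (sym (letterAt-tabulate f i<n))

-- Super-strong Wilf equivalence of the three patterns

superStronglyWilf : ∀ p p′ →
  (∀ n (T : Subset n) → #⊇ T (map (Em p) (𝐈 n)) ≡ #⊇ T (map (Em p′) (𝐈 n))) →
  SuperStronglyWilfEquivalent p p′
superStronglyWilf p p′ h n T = begin
  countEm n p T              ≡⟨ length-filter-map (λ U → Vec-≡-dec _≟ᵇ_ U T) (Em p) (𝐈 n) ⟨
  #≡ T (map (Em p) (𝐈 n))    ≡⟨ möbius n (map (Em p) (𝐈 n)) (map (Em p′) (𝐈 n)) (h n) T ⟩
  #≡ T (map (Em p′) (𝐈 n))   ≡⟨ length-filter-map (λ U → Vec-≡-dec _≟ᵇ_ U T) (Em p′) (𝐈 n) ⟩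
  countEm n p′ T             ∎
  where open ≡-Reasoning

mainTheorem7 : ∀ (r s : ℕ) → 1 ≤ r → 2 ≤ s →
    SuperStronglyWilfEquivalent (Q₁ r s) (Q₂ r s) ×
    SuperStronglyWilfEquivalent (Q₁ r s) (Q₃ r s) ×
    SuperStronglyWilfEquivalent (Q₂ r s) (Q₃ r s)
-- `Q₃` is the middle term: it is compared with `Q₁` by refilling the `m`, with `Q₂` by refilling
-- the `x′`.
mainTheorem7 r s 0<r 1<s = (λ n T → trans (Q₁~Q₃ n T) (sym (Q₂~Q₃ n T))) , Q₁~Q₃ , Q₂~Q₃
  where
  0<s : 0 < s
  0<s = <⇒≤ 1<s
  Q₁~Q₃ : SuperStronglyWilfEquivalent (Q₁ r s) (Q₃ r s)
  Q₁~Q₃ = superStronglyWilf (Q₁ r s) (Q₃ r s) λ n T → let open Rows 0<r 0<s (Position T) in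
    ≤-antisym
    (#⊇-≤ 0<s T LinkedCell (spelt₁ r s 0<r 0<s) (spelt₃ r s 0<r 0<s)
      occurs⇒conditions₁ conditions₃⇒occurs
      (Exchange.extend₁₃ (position? T) n) (Exchange.determined₁ (position? T) n))
    (#⊇-≤ 0<s T LinkedCell (spelt₃ r s 0<r 0<s) (spelt₁ r s 0<r 0<s)
      occurs⇒conditions₃ conditions₁⇒occurs
      (Exchange.extend₃₁ (position? T) n) (Exchange.determined₃-cell (position? T) n))
  Q₂~Q₃ : SuperStronglyWilfEquivalent (Q₂ r s) (Q₃ r s)
  Q₂~Q₃ = superStronglyWilf (Q₂ r s) (Q₃ r s) λ n T → let open Rows 0<r 0<s (Position T) in
    ≤-antisym
    (#⊇-≤ 0<s T LinkedRow (spelt₂ r s 0<r 0<s) (spelt₃ r s 0<r 0<s)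
      occurs⇒conditions₂ conditions₃⇒occurs
      (Exchange.extend₂₃ (position? T) n) (Exchange.determined₂ (position? T) n))
    (#⊇-≤ 0<s T LinkedRow (spelt₃ r s 0<r 0<s) (spelt₂ r s 0<r 0<s)
      occurs⇒conditions₃ conditions₂⇒occurs
      (Exchange.extend₃₂ (position? T) n) (Exchange.determined₃-row (position? T) n))
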